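{- There exist exactly $203$ positive integers $N$ with the following property: for some integer $d \geq 2$, $N$ is a $d$-digit palindrome base $10$ and $N$ is also a $d$-digit palindrome base $b$ for some integer base $b \geq 2$ with $b \neq 10$. Moreover, the smallest such $N$ is $22$, the largest such $N$ is $9986831781362631871386899$, and the values of $d$ that occur for such $N$ are exactly $$d = 2,\, 3,\, 4,\, 5,\, 6,\, 7,\, 9,\, 11,\, 13,\, 15,\, 17,\, 19,\, 21,\, 23,\, 25.$$
   Context: For an integer $b \geq 2$ and a positive integer $N$, write the base $b$ expansion $N = a_d\, b^{d-1} + \cdots + a_2\, b + a_1$ with integers $0 \leq a_k < b$. $N$ is called a $d$-digit number base $b$ if $a_d \neq 0$ in this expansion (so $b^{d-1} \leq N < b^d$). Such a $d$-digit number is called a $d$-digit palindrome base $b$ if $a_{d-k+1} = a_k$ for all $k = 1, 2, \dots, d$. The number of digits $d$ is required to be the same in base $10$ and in base $b$. -}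

module Defs where

open import Data.Digit using (Digit; fromDigits)
open import Data.Fin.Base using (Fin; toℕ; opposite)
open import Data.Nat.Base using (ℕ; suc; _≤_; _<_)
open import Data.Product.Base using (Σ-syntax; ∃-syntax; _×_)
open import Data.Vec.Base using (Vec; lookup; toList)
open import Relation.Binary.PropositionalEquality.Core using (_≡_; _≢_)

-- Digits are stored least significant first: the digit aₖ of
-- N = a_d b^(d-1) + ⋯ + a₂ b + a₁ sits at index k - 1.  As `last` is a
-- witness, there are no 0-digit numbers.
record IsDigitNumber (d b N : ℕ) : Set where
  field
    digits     : Vec (Digit b) d
    expansion  : fromDigits (toList digits) ≡ N
    last       : Fin d
    last-index : suc (toℕ last) ≡ d
    leading≢0  : toℕ (lookup digits last) ≢ 0

-- `opposite` sends the index k - 1 of aₖ to d - k, the index of a_(d-k+1).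
IsPalindrome : (d b N : ℕ) → Set
IsPalindrome d b N =
  Σ[ n ∈ IsDigitNumber d b N ]
    let open IsDigitNumber n in
    ∀ (k : Fin d) → lookup digits (opposite k) ≡ lookup digits k

IsDoublePalindrome : (d N : ℕ) → Set
IsDoublePalindrome d N =
  0 < N × 2 ≤ d × IsPalindrome d 10 N ×
  (∃[ b ] (2 ≤ b × b ≢ 10 × IsPalindrome d b N))

-- A d-digit palindrome in base b is a fixed linear form in its first ⌈ d /2⌉ digits, so the numbers
-- that are palindromes in bases 10 and b are the integer points v of a box on a hyperplane
-- f ∙ v = 0.  Comparing b ^ (d - 1) ≤ N < 10 ^ d with 10 ^ (d - 1) ≤ N < b ^ d leaves d ≤ 25 and
-- b < 100.  For d ≤ 8 the points are found by branching on the digits, from the outermost inwards.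
-- For larger d that tree is too large, and we branch instead on the values of the integral linear
-- forms dual to an LLL-reduced basis of the lattice f ∙ v = 0.  The next value is bounded by the
-- range, over the box, of an integral combination of the new form, the earlier forms and f with
-- small coefficients; good combinations come from dual solutions of linear programs.  The resulting
-- trees have fewer than 20000 nodes.  The forms and combinations are data that need no
-- justification: every integral combination gives a valid bound.
module Submission where

open import Defs
open import Data.Bool.Base using (Bool; true; false; T; _∧_; not; if_then_else_)
open import Data.Bool.ListAction using (any; all)
open import Data.Bool.Properties using (T-∧; T-≡)
open import Data.Digit using (Digit; fromDigits)
open import Data.Fin.Base as Fin using (Fin; zero; suc; toℕ; fromℕ; inject₁; opposite; _↑ˡ_; _↑ʳ_)
import Data.Fin.Properties as Fin
open import Data.Integer.Base as ℤ using (ℤ; +_; -[1+_]; 0ℤ; 1ℤ; _+_; _*_; -_; _-_; _≤ᵇ_; _/ℕ_; ∣_∣)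
open import Data.Integer.DivMod using (n<s[n/ℕd]*d)
import Data.Integer.Properties as ℤ
import Data.Integer.Tactic.RingSolver as ℤSolver
open import Data.List.Base as List using (List; length; []; _∷_; _++_; upTo)
open import Data.List.Membership.Propositional using (_∈_; find)
open import Data.List.Membership.Propositional.Properties using (∈-map⁺; ∈-map⁻; ∈-upTo⁺)
open import Data.List.Relation.Binary.Pointwise.Base using ([]; _∷_) renaming (Pointwise to ListPointwise)
open import Data.List.Relation.Unary.All as All using (All; []; _∷_)
open import Data.List.Relation.Unary.All.Properties using (all⁺)
open import Data.List.Relation.Unary.AllPairs using (allPairs?)
open import Data.List.Relation.Unary.Any as Any using (Any; any?)
open import Data.List.Relation.Unary.Any.Properties using (any⁻)
open import Data.List.Relation.Unary.Unique.Propositional using (Unique)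
open import Data.Maybe as Maybe using (Maybe; nothing; is-just; to-witness-T)
open import Data.Nat.Base as ℕ using (ℕ; zero; suc; _≤_; _<_; _^_; _≡ᵇ_; _<ᵇ_; ⌈_/2⌉; NonZero; s≤s; z≤n)
open import Data.Nat.DivMod using (_mod_)
import Data.Nat.Properties as ℕ
import Data.Nat.Tactic.RingSolver as ℕSolver
open import Data.Product.Base using (Σ-syntax; ∃-syntax; _×_; _,_; proj₁; proj₂)
open import Data.Unit.Base using (tt)
open import Data.Vec.Base as Vec using (Vec; []; _∷_; _∷ʳ_; _[_]≔_; initLast; lookup; replicate; toList; zipWith)
open import Data.Vec.Relation.Binary.Pointwise.Inductive using (Pointwise; []; _∷_; ++⁺)
open import Function.Bundles using (_⇔_; mk⇔; module Equivalence)
open import Relation.Binary.Definitions using (tri<; tri≈; tri>)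
open import Relation.Binary.PropositionalEquality
open import Relation.Nullary.Decidable using (Dec; yes; _×-dec_; ¬?; dec⇒maybe; does)
open import Relation.Nullary.Negation using (¬_)

open import Data.List.Membership.DecPropositional ℕ._≟_ using (_∈?_)

-- The obstacle is the size of the coefficients of `f`, the largest of which exceed `10 ^ (d - 1)`:
-- over the box a form of comparable size has a huge range, and bounding it directly prunes nothing.
-- On `f ∙ v = 0`, however, a form matters only modulo real multiples of `f`, and a form `g` close
-- to `t f` for a real `t` takes few values there. So a form carries a rational approximation
-- `τ / Q` of `t`, and ranges are taken of the integral form `Q g - τ f`. Completeness then becomes
-- one Boolean evaluation. At every node the swept interval contains the value taken by any given
-- solution, so the truth of the check descends along the branch of that solution to a leaf, where
-- its `N` is looked up in the table. A poor choice of forms can only enlarge the tree or make the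
-- check fail.

private variable
  n : ℕ
  A : Set

-- Integral linear forms

infixl 7 _∙_
infixl 6 _⊕_

_∙_ : Vec ℤ n → Vec ℤ n → ℤ
[]      ∙ []      = 0ℤ
(a ∷ p) ∙ (x ∷ v) = a * x + p ∙ v

_⊕_ : Vec ℤ n → Vec ℤ n → Vec ℤ n
_⊕_ = zipWith _+_

scale : ℤ → Vec ℤ n → Vec ℤ n
scale a = Vec.map (a *_)

⊕-∙ : ∀ (p q v : Vec ℤ n) → (p ⊕ q) ∙ v ≡ p ∙ v + q ∙ v
⊕-∙ []      []      []      = refl
⊕-∙ (a ∷ p) (b ∷ q) (x ∷ v) =
  trans (cong (λ s → (a + b) * x + s) (⊕-∙ p q v)) (lemma a b x (p ∙ v) (q ∙ v))
  where
  lemma : ∀ a b x y z → (a + b) * x + (y + z) ≡ (a * x + y) + (b * x + z)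
  lemma = ℤSolver.solve-∀

scale-∙ : ∀ a (p v : Vec ℤ n) → scale a p ∙ v ≡ a * (p ∙ v)
scale-∙ a []      []      = sym (ℤ.*-zeroʳ a)
scale-∙ a (b ∷ p) (x ∷ v) = trans (cong (λ s → a * b * x + s) (scale-∙ a p v)) (lemma a b x (p ∙ v))
  where
  lemma : ∀ a b x y → a * b * x + a * y ≡ a * (b * x + y)
  lemma = ℤSolver.solve-∀

0-∙ : ∀ (v : Vec ℤ n) → replicate n 0ℤ ∙ v ≡ 0ℤ
0-∙ []      = refl
0-∙ (x ∷ v) = cong₂ _+_ (ℤ.*-zeroˡ x) (0-∙ v)

++-∙ : ∀ {m} (p v : Vec ℤ m) (q w : Vec ℤ n) → (p Vec.++ q) ∙ (v Vec.++ w) ≡ p ∙ v + q ∙ w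
++-∙ []      []      q w = sym (ℤ.+-identityˡ (q ∙ w))
++-∙ (a ∷ p) (x ∷ v) q w =
  trans (cong (λ s → a * x + s) (++-∙ p v q w)) (sym (ℤ.+-assoc (a * x) (p ∙ v) (q ∙ w)))

-- Rounded division and intervals

⌊_/_⌋ ⌈_/_⌉ : ℤ → (k : ℕ) .{{_ : NonZero k}} → ℤ
⌊ t / k ⌋ = t /ℕ k
-- `/ℕ` rounds down for negative dividends too, so the two negations turn it into rounding up.
⌈ t / k ⌉ = - ((- t) /ℕ k)

-- The bound `t < (t /ℕ k + 1) * k` is strict, so cancelling `k` gives a strict inequality between
-- integers, which is improved by one.
≤⌊/⌋ : ∀ {x t} k .{{_ : NonZero k}} → + k * x ℤ.≤ t → x ℤ.≤ ⌊ t / k ⌋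
≤⌊/⌋ {x} {t} k@(suc _) kx≤t = subst (x ℤ.≤_) (ℤ.pred-suc _) (ℤ.i<j⇒i≤pred[j]
  (ℤ.*-cancelʳ-<-nonNeg {x} {ℤ.suc (t /ℕ k)} (+ k)
    (ℤ.≤-<-trans (subst (ℤ._≤ t) (ℤ.*-comm (+ k) x) kx≤t) (n<s[n/ℕd]*d t k))))

⌈/⌉≤ : ∀ {x t} k .{{_ : NonZero k}} → t ℤ.≤ + k * x → ⌈ t / k ⌉ ℤ.≤ x
⌈/⌉≤ {x} {t} k t≤kx = subst (⌈ t / k ⌉ ℤ.≤_) (ℤ.neg-involutive x) (ℤ.neg-mono-≤
  (≤⌊/⌋ k (subst (ℤ._≤ - t) (ℤ.neg-distribʳ-* (+ k) x) (ℤ.neg-mono-≤ t≤kx))))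

-- Nothing forces the ends to be in order: a pair `(l , u)` with `u < l` is empty and stands for a
-- dead branch.
Interval : Set
Interval = ℤ × ℤ

infix 4 _∈ᴵ_ _∈ᴮ_

_∈ᴵ_ : ℤ → Interval → Set
x ∈ᴵ (l , u) = l ℤ.≤ x × x ℤ.≤ u

_∩_ : Interval → Interval → Interval
(l , u) ∩ (l′ , u′) = (if l ≤ᵇ l′ then l′ else l) , (if u ≤ᵇ u′ then u else u′)

∈-∩ : ∀ {x} i j → x ∈ᴵ i → x ∈ᴵ j → x ∈ᴵ i ∩ j
∈-∩ (l , u) (l′ , u′) (l≤x , x≤u) (l′≤x , x≤u′) = lower (l ≤ᵇ l′) , upper (u ≤ᵇ u′)
  where
  lower : ∀ b → (if b then l′ else l) ℤ.≤ _
  lower true  = l′≤x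
  lower false = l≤x
  upper : ∀ b → _ ℤ.≤ (if b then u else u′)
  upper true  = x≤u
  upper false = x≤u′

quotients : (k : ℕ) .{{_ : NonZero k}} → Interval → Interval
quotients k (l , u) = ⌈ l / k ⌉ , ⌊ u / k ⌋

∈-quotients : ∀ {x} k .{{_ : NonZero k}} i → + k * x ∈ᴵ i → x ∈ᴵ quotients k i
∈-quotients k (l , u) (l≤kx , kx≤u) = ⌈/⌉≤ k l≤kx , ≤⌊/⌋ k kx≤u

translate : ℤ → Interval → Interval
translate s (l , u) = l - s , u - s

∈-translate : ∀ {x} s i → x + s ∈ᴵ i → x ∈ᴵ translate s i
∈-translate {x} s (l , u) (l≤ , ≤u) =
  subst (l - s ℤ.≤_) (lemma x s) (ℤ.+-monoˡ-≤ (- s) l≤) ,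
  subst (ℤ._≤ u - s) (lemma x s) (ℤ.+-monoˡ-≤ (- s) ≤u)
  where
  lemma : ∀ x s → x + s - s ≡ x
  lemma = ℤSolver.solve-∀

-- Exhausting the integers of an interval

allFrom : ℕ → ℤ → (ℤ → Bool) → Bool
allFrom zero    l P = true
allFrom (suc k) l P = P l ∧ allFrom k (l + 1ℤ) P

allFrom-sound : ∀ n l P {k} → k ℕ.< n → T (allFrom n l P) → T (P (l + + k))
allFrom-sound (suc n) l P {zero}  _         h =
  subst (λ c → T (P c)) (sym (ℤ.+-identityʳ l)) (proj₁ (Equivalence.to T-∧ h))
allFrom-sound (suc n) l P {suc k} (ℕ.s≤s k<n) h =
  subst (λ c → T (P c)) (ℤ.+-assoc l 1ℤ (+ k))
    (allFrom-sound n (l + 1ℤ) P k<n (proj₂ (Equivalence.to (T-∧ {P l}) h)))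

nonEmpty : Interval → Bool
nonEmpty (l , u) = l ≤ᵇ u

-- For `u < l` the number `∣ u - l ∣` would still be positive and the sweep would visit integers
-- outside the interval; hence the test.
allIn : Interval → (ℤ → Bool) → Bool
allIn (l , u) P = if l ≤ᵇ u then allFrom (suc ∣ u - l ∣) l P else true

allIn-sound : ∀ {x} i P → x ∈ᴵ i → T (allIn i P) → T (P x)
allIn-sound {x} (l , u) P (l≤x , x≤u) h with l ≤ᵇ u | ℤ.≤⇒≤ᵇ (ℤ.≤-trans l≤x x≤u)
... | true | _ = subst (λ c → T (P c)) l+k≡x (allFrom-sound (suc ∣ u - l ∣) l P (ℕ.s≤s k≤) h)
  where
  0≤x-l : 0ℤ ℤ.≤ x - l
  0≤x-l = ℤ.i≤j⇒0≤j-i l≤x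
  +k≡ : + ∣ x - l ∣ ≡ x - l
  +k≡ = ℤ.0≤i⇒+∣i∣≡i 0≤x-l
  0≤u-l : 0ℤ ℤ.≤ u - l
  0≤u-l = ℤ.i≤j⇒0≤j-i (ℤ.≤-trans l≤x x≤u)
  k≤ : ∣ x - l ∣ ℕ.≤ ∣ u - l ∣
  k≤ = ℤ.drop‿+≤+ (subst₂ ℤ._≤_ (sym +k≡) (sym (ℤ.0≤i⇒+∣i∣≡i 0≤u-l)) (ℤ.+-monoˡ-≤ (- l) x≤u))
  lemma : ∀ l x → l + (x - l) ≡ x
  lemma = ℤSolver.solve-∀
  l+k≡x : l + + ∣ x - l ∣ ≡ x
  l+k≡x = trans (cong (λ s → l + s) +k≡) (lemma l x)

-- Ranges of forms over boxes, and tightening a box on a hyperplane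

Box : ℕ → Set
Box = Vec Interval

_∈ᴮ_ : Vec ℤ n → Box n → Set
_∈ᴮ_ = Pointwise _∈ᴵ_

multiples : ℤ → Interval → Interval
multiples a@(+ _)     (l , u) = a * l , a * u
multiples a@(-[1+ _ ]) (l , u) = a * u , a * l

∈-multiples : ∀ a {x} i → x ∈ᴵ i → a * x ∈ᴵ multiples a i
∈-multiples a@(+ _)      i (l≤x , x≤u) = ℤ.*-monoˡ-≤-nonNeg a l≤x , ℤ.*-monoˡ-≤-nonNeg a x≤u
∈-multiples a@(-[1+ _ ]) i (l≤x , x≤u) = ℤ.*-monoˡ-≤-nonPos a x≤u , ℤ.*-monoˡ-≤-nonPos a l≤x

_+ᴵ_ : Interval → Interval → Interval
(l , u) +ᴵ (l′ , u′) = l + l′ , u + u′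

∈-+ᴵ : ∀ {x y} {i j} → x ∈ᴵ i → y ∈ᴵ j → x + y ∈ᴵ i +ᴵ j
∈-+ᴵ (l≤x , x≤u) (l≤y , y≤u) = ℤ.+-mono-≤ l≤x l≤y , ℤ.+-mono-≤ x≤u y≤u

-- On a nonempty box both ends are attained at corners, so nothing is lost for a single form.
-- Interval arithmetic loses only when ranges of several forms are added, which is why a rule
-- combines forms first and takes the range of the result.
values : Vec ℤ n → Box n → Interval
values []      []      = 0ℤ , 0ℤ
values (a ∷ p) (i ∷ B) = multiples a i +ᴵ values p B

∈-values : ∀ (p : Vec ℤ n) {v B} → v ∈ᴮ B → p ∙ v ∈ᴵ values p B
∈-values []      []            = ℤ.≤-refl , ℤ.≤-refl
∈-values (a ∷ p) (x∈i ∷ v∈B) = ∈-+ᴵ (∈-multiples a _ x∈i) (∈-values p v∈B)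

-- On f ∙ v = 0 the term a * x is minus the sum of the other terms, and the range of that sum
-- is the range (L , U) of all of f ∙ v less the contribution of a * x.
narrowed : Interval → ℤ → Interval → Interval
narrowed (L , U) a i = go a (multiples a i)
  where
  go : ℤ → Interval → Interval
  go (+ zero)     _       = i
  go (+ suc k)    (l , u) = i ∩ quotients (suc k) (u - U , l - L)
  go (-[1+ k ])   (l , u) = i ∩ quotients (suc k) (L - l , U - u)

tighten : Vec ℤ n → Box n → Box n
tighten f B = zipWith (narrowed (values f B)) f B

-- Here `y` is the sum of the other terms. Removing the ends of `multiples a i` from those of the
-- total range gives back exactly the ends of `j`.
∈-narrowed : ∀ a {x y i j} → x ∈ᴵ i → y ∈ᴵ j → a * x + y ≡ 0ℤ →
             x ∈ᴵ narrowed (multiples a i +ᴵ j) a i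
∈-narrowed (+ zero) x∈i y∈j eq = x∈i
∈-narrowed a@(+ suc k) {x} {y} {l , u} {l′ , u′} x∈i (l′≤y , y≤u′) eq =
  ∈-∩ (l , u) _ x∈i (∈-quotients (suc k) _
    ( subst₂ ℤ._≤_ (lemma₁ (a * u) u′) (sym ax≡-y) (ℤ.neg-mono-≤ y≤u′)
    , subst₂ ℤ._≤_ (sym ax≡-y) (lemma₁ (a * l) l′) (ℤ.neg-mono-≤ l′≤y)))
  where
  lemma₁ : ∀ s t → - t ≡ s - (s + t)
  lemma₁ = ℤSolver.solve-∀
  lemma₂ : ∀ s t → s ≡ (s + t) - t
  lemma₂ = ℤSolver.solve-∀
  ax≡-y : a * x ≡ - y
  ax≡-y = trans (lemma₂ (a * x) y) (trans (cong (_- y) eq) (ℤ.+-identityˡ (- y)))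
∈-narrowed a@(-[1+ k ]) {x} {y} {l , u} {l′ , u′} x∈i (l′≤y , y≤u′) eq =
  ∈-∩ (l , u) _ x∈i (∈-quotients (suc k) _
    ( subst₂ ℤ._≤_ (lemma₁ (a * u) l′) y≡ l′≤y
    , subst₂ ℤ._≤_ y≡ (lemma₁ (a * l) u′) y≤u′))
  where
  lemma₁ : ∀ s t → t ≡ s + t - s
  lemma₁ = ℤSolver.solve-∀
  lemma₂ : ∀ s t → t ≡ (s + t) - s
  lemma₂ = ℤSolver.solve-∀
  y≡ : y ≡ + suc k * x
  y≡ = trans (lemma₂ (a * x) y) (trans (cong (_- a * x) eq)
         (trans (ℤ.+-identityˡ _) (ℤ.neg-distribˡ-* a x)))

∈-tighten : ∀ (f : Vec ℤ n) {v B} → v ∈ᴮ B → f ∙ v ≡ 0ℤ → v ∈ᴮ tighten f B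
∈-tighten {n} f {v} {B} v∈B eq = subst (λ j → v ∈ᴮ zipWith (narrowed j) f B) (+ᴵ-identityˡ (values f B))
  (go f {j = 0ℤ , 0ℤ} {y = 0ℤ} (ℤ.≤-refl , ℤ.≤-refl) v∈B (trans (ℤ.+-identityˡ _) eq))
  where
  +ᴵ-identityˡ : ∀ i → (0ℤ , 0ℤ) +ᴵ i ≡ i
  +ᴵ-identityˡ (l , u) = cong₂ _,_ (ℤ.+-identityˡ l) (ℤ.+-identityˡ u)
  swap : ∀ s t r → s + (t + r) ≡ t + (s + r)
  swap = ℤSolver.solve-∀
  assoc : ∀ s t r → s + t + r ≡ s + (t + r)
  assoc = ℤSolver.solve-∀
  -- The induction has to carry the terms already passed: `y` is their sum and `j` its range. Moving
  -- a term from `f` to `y` leaves the total range unchanged, up to `swap` and `assoc`, so every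
  -- coordinate is narrowed against the same range.
  go : ∀ {n} (f : Vec ℤ n) {v B j y} → y ∈ᴵ j → v ∈ᴮ B → y + f ∙ v ≡ 0ℤ →
       v ∈ᴮ zipWith (narrowed (j +ᴵ values f B)) f B
  go []      y∈j []          eq = []
  go (a ∷ f) {x ∷ v} {i ∷ B} {j} {y} y∈j (x∈i ∷ v∈B) eq =
    subst (λ k → x ∈ᴵ narrowed k a i)
      (cong₂ _,_ (swap (proj₁ ai) (proj₁ j) (proj₁ fB)) (swap (proj₂ ai) (proj₂ j) (proj₂ fB)))
      (∈-narrowed a x∈i (∈-+ᴵ y∈j (∈-values f v∈B)) (trans (swap (a * x) y (f ∙ v)) eq))
    ∷ subst (λ k → v ∈ᴮ zipWith (narrowed k) f B)
      (cong₂ _,_ (assoc (proj₁ j) (proj₁ ai) (proj₁ fB)) (assoc (proj₂ j) (proj₂ ai) (proj₂ fB)))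
      (go f (∈-+ᴵ y∈j (∈-multiples a i x∈i)) v∈B (trans (assoc y (a * x) (f ∙ v)) eq))
    where
    ai = multiples a i
    fB = values f B

-- The search tree

-- Missing multipliers count as 0, so a rule may stop at the oldest form that it uses; `weighted`
-- truncates in the same way.
combine : List ℤ → List (Vec ℤ n) → Vec ℤ n
combine (a ∷ as) (p ∷ ps) = scale a p ⊕ combine as ps
combine []       _        = replicate _ 0ℤ
combine (_ ∷ _)  []       = replicate _ 0ℤ

weighted : List ℤ → List ℤ → ℤ
weighted (a ∷ as) (c ∷ cs) = a * c + weighted as cs
weighted []       _        = 0ℤ
weighted (_ ∷ _)  []       = 0ℤ

-- constraint k as i  demands  suc k * c + weighted as cs ∈ᴵ i  of the value c of a form, where cs
-- are the values of the earlier forms, latest first.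
record Constraint : Set where
  constructor constraint
  field
    predMultiplier : ℕ
    multipliers    : List ℤ
    interval       : Interval

solutions : Constraint → List ℤ → Interval
solutions (constraint k as i) cs = quotients (suc k) (translate (weighted as cs) i)

-- Further intersections cannot revive an empty interval, so the remaining rules are not evaluated.
narrow : List Constraint → List ℤ → Interval → Interval
narrow []       cs i = i
narrow (C ∷ Cs) cs i = if nonEmpty i then narrow Cs cs (i ∩ solutions C cs) else i

-- The list `cs` records the values chosen so far, latest first; below the last level its head is
-- the value of the final form, and only this value is tested. A level without rules leaves its
-- value unbounded, so the check fails there.
run : (ℤ → Bool) → List (List Constraint) → List ℤ → Bool
run leaf []              []      = false
run leaf []              (c ∷ _) = leaf c
run leaf ([] ∷ _)        cs      = false
run leaf ((C ∷ Cs) ∷ Ls) cs      =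
  allIn (narrow Cs cs (solutions C cs)) (λ c → run leaf Ls (c ∷ cs))

Holds : ℤ → List ℤ → Constraint → Set
Holds c cs C = c ∈ᴵ solutions C cs

∈-narrow : ∀ {c cs Cs} i → c ∈ᴵ i → All (Holds c cs) Cs → c ∈ᴵ narrow Cs cs i
∈-narrow i c∈i []       = c∈i
∈-narrow {Cs = C ∷ Cs} i c∈i (h ∷ hs) with nonEmpty i
... | true  = ∈-narrow (i ∩ _) (∈-∩ i _ c∈i h) hs
... | false = c∈i

-- The value taken by an actual solution is among those swept by `allIn`, so the truth of the check
-- passes from a node to the child on the branch of that solution.
run-sound : ∀ leaf Cs Ls {c cs} → All (Holds c cs) Cs → T (run leaf (Cs ∷ Ls) cs) →
            T (run leaf Ls (c ∷ cs))
run-sound leaf (C ∷ Cs) Ls {c} {cs} (h ∷ hs) =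
  allIn-sound (narrow Cs cs (solutions C cs)) (λ c → run leaf Ls (c ∷ cs)) (∈-narrow _ h hs)

-- From forms and rules to constraints on their values

record Level (n : ℕ) : Set where
  constructor level
  field
    form       : Vec ℤ n
    correction : ℤ
    rules      : List (ℕ × List ℤ)

open Level

module _ (Q : ℕ) .{{_ : NonZero Q}} (f : Vec ℤ n) (B : Box n) where

  -- On f ∙ v = 0 this is Q times the form, but for a good correction its coefficients are smaller
  -- than those of Q times the form.
  reduced : Level n → Vec ℤ n
  reduced L = scale (+ Q) (form L) ⊕ scale (- correction L) f

  -- The range over the box is computed once per level. At the nodes only the numbers `cs` vary, so
  -- a node costs a few integer operations, independent of the coefficients of the forms.
  toConstraint : List (Vec ℤ n) → ℕ × List ℤ → Constraint
  toConstraint ps (k , as) = constraint k as (quotients Q (values (combine (+ suc k ∷ as) ps) B))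

  -- The final level stays outside the list so that the value reaching `leaf` is visibly the value
  -- of its form.
  compile : List (Vec ℤ n) → List (Level n) → Level n → List (List Constraint)
  compile ps []       L′ = List.map (toConstraint (reduced L′ ∷ ps)) (rules L′) ∷ []
  compile ps (L ∷ Ls) L′ = List.map (toConstraint (reduced L ∷ ps)) (rules L)
                         ∷ compile (reduced L ∷ ps) Ls L′

  module _ {v : Vec ℤ n} (v∈B : v ∈ᴮ B) (fv≡0 : f ∙ v ≡ 0ℤ) where

    -- The forms are the reduced ones and the values belong to the original forms, whence the factor
    -- `Q`. The form `f` itself fits this pattern with the value 0.
    Known : List (Vec ℤ n) → List ℤ → Set
    Known = ListPointwise (λ p c → p ∙ v ≡ + Q * c)

    reduced-∙ : ∀ L → reduced L ∙ v ≡ + Q * (form L ∙ v)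
    reduced-∙ (level g τ _) = begin
      (scale (+ Q) g ⊕ scale (- τ) f) ∙ v      ≡⟨ ⊕-∙ (scale (+ Q) g) (scale (- τ) f) v ⟩
      scale (+ Q) g ∙ v + scale (- τ) f ∙ v    ≡⟨ cong₂ _+_ (scale-∙ (+ Q) g v) (scale-∙ (- τ) f v) ⟩
      + Q * (g ∙ v) + - τ * (f ∙ v)            ≡⟨ cong (λ z → + Q * (g ∙ v) + - τ * z) fv≡0 ⟩
      + Q * (g ∙ v) + - τ * 0ℤ                 ≡⟨ lemma (+ Q * (g ∙ v)) τ ⟩
      + Q * (g ∙ v)                            ∎
      where
      open ≡-Reasoning
      lemma : ∀ x y → x + - y * 0ℤ ≡ x
      lemma = ℤSolver.solve-∀

    combine-∙ : ∀ as {ps cs} → Known ps cs → combine as ps ∙ v ≡ + Q * weighted as cs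
    combine-∙ []       _  = trans (0-∙ v) (sym (ℤ.*-zeroʳ (+ Q)))
    combine-∙ (_ ∷ _)  [] = trans (0-∙ v) (sym (ℤ.*-zeroʳ (+ Q)))
    combine-∙ (a ∷ as) {p ∷ ps} {c ∷ cs} (eq ∷ known) = begin
      (scale a p ⊕ combine as ps) ∙ v        ≡⟨ ⊕-∙ (scale a p) (combine as ps) v ⟩
      scale a p ∙ v + combine as ps ∙ v      ≡⟨ cong₂ _+_ (trans (scale-∙ a p v) (cong (λ x → a * x) eq))
                                                       (combine-∙ as known) ⟩
      a * (+ Q * c) + + Q * weighted as cs   ≡⟨ lemma a (+ Q) c (weighted as cs) ⟩
      + Q * (a * c + weighted as cs)         ∎
      where
      open ≡-Reasoning
      lemma : ∀ a q c w → a * (q * c) + q * w ≡ q * (a * c + w)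
      lemma = ℤSolver.solve-∀

    holds : ∀ {p ps c cs} → Known (p ∷ ps) (c ∷ cs) → ∀ r → Holds c cs (toConstraint (p ∷ ps) r)
    holds {p} {ps} {c} {cs} known (k , as) =
      -- From the inside outwards: the range of `h` over the box, division by `Q`, removal of the
      -- contribution of the earlier values, division by the multiplier of the new form.
      ∈-quotients (suc k) _ (∈-translate (weighted as cs) _ (∈-quotients Q _
        (subst (_∈ᴵ values h B) (combine-∙ (+ suc k ∷ as) known) (∈-values h v∈B))))
      where
      h = combine (+ suc k ∷ as) (p ∷ ps)

    allHold : ∀ {p ps c cs} → Known (p ∷ ps) (c ∷ cs) → ∀ rs →
              All (Holds c cs) (List.map (toConstraint (p ∷ ps)) rs)
    allHold known []       = []
    allHold known (r ∷ rs) = holds known r ∷ allHold known rs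

    -- Induction down the branch of `v`: at each level the value recorded is `form L ∙ v`. The
    -- forms, corrections and rules are arbitrary.
    compile-sound : ∀ leaf Ls L′ {ps cs} → Known ps cs →
                    T (run leaf (compile ps Ls L′) cs) → T (leaf (form L′ ∙ v))
    compile-sound leaf [] L′ {ps} known h =
      run-sound leaf _ [] (allHold {reduced L′} (reduced-∙ L′ ∷ known) (rules L′)) h
    compile-sound leaf (L ∷ Ls) L′ {ps} known h =
      compile-sound leaf Ls L′ {reduced L ∷ ps} (reduced-∙ L ∷ known)
        (run-sound leaf _ (compile (reduced L ∷ ps) Ls L′)
          (allHold {reduced L} (reduced-∙ L ∷ known) (rules L)) h)

-- Palindromes as linear forms in half of their digits

lookup-∷ʳ-inject₁ : ∀ (xs : Vec A n) y i → lookup (xs ∷ʳ y) (inject₁ i) ≡ lookup xs i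
lookup-∷ʳ-inject₁ (x ∷ xs) y zero    = refl
lookup-∷ʳ-inject₁ (x ∷ xs) y (suc i) = lookup-∷ʳ-inject₁ xs y i

lookup-∷ʳ-fromℕ : ∀ (xs : Vec A n) y → lookup (xs ∷ʳ y) (fromℕ n) ≡ y
lookup-∷ʳ-fromℕ []       y = refl
lookup-∷ʳ-fromℕ (x ∷ xs) y = lookup-∷ʳ-fromℕ xs y

opposite-inject₁ : ∀ (i : Fin n) → opposite (inject₁ i) ≡ suc (opposite i)
opposite-inject₁ zero    = refl
opposite-inject₁ (suc i) = cong inject₁ (opposite-inject₁ i)

IsSymmetric : Vec A n → Set
IsSymmetric xs = ∀ k → lookup xs (opposite k) ≡ lookup xs k

symmetric-last : ∀ {x y} (xs : Vec A n) → IsSymmetric (x ∷ (xs ∷ʳ y)) → y ≡ x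
symmetric-last {y = y} xs sym-xs = trans (sym (lookup-∷ʳ-fromℕ xs y)) (sym-xs zero)

-- Stripping both ends commutes with reflection: in the long vector, reflection sends
-- `suc (inject₁ k)` to `suc (inject₁ (opposite k))`.
symmetric-inner : ∀ {x y} (xs : Vec A n) → IsSymmetric (x ∷ (xs ∷ʳ y)) → IsSymmetric xs
symmetric-inner {x = x} {y} xs sym-xs k = begin
  lookup xs (opposite k)                                    ≡⟨ lookup-∷ʳ-inject₁ xs y (opposite k) ⟨
  lookup (x ∷ (xs ∷ʳ y)) (suc (inject₁ (opposite k)))       ≡⟨ cong (λ i → lookup (x ∷ (xs ∷ʳ y)) (inject₁ i))
                                                                    (opposite-inject₁ k) ⟨
  lookup (x ∷ (xs ∷ʳ y)) (opposite (suc (inject₁ k)))       ≡⟨ sym-xs (suc (inject₁ k)) ⟩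
  lookup (xs ∷ʳ y) (inject₁ k)                              ≡⟨ lookup-∷ʳ-inject₁ xs y k ⟩
  lookup xs k                                               ∎
  where open ≡-Reasoning

value : ∀ {b} → Vec (Digit b) n → ℕ
value xs = fromDigits (toList xs)

value-∷ʳ : ∀ {b} (xs : Vec (Digit b) n) y → value (xs ∷ʳ y) ≡ value xs ℕ.+ toℕ y ℕ.* b ^ n
value-∷ʳ []       y = trans (ℕ.+-identityʳ (toℕ y)) (sym (ℕ.*-identityʳ (toℕ y)))
value-∷ʳ {suc n} {b} (x ∷ xs) y = trans (cong (λ s → toℕ x ℕ.+ s ℕ.* b) (value-∷ʳ xs y))
  (lemma (toℕ x) (value xs) (toℕ y) (b ^ n) b)
  where
  lemma : ∀ x s y c b → x ℕ.+ (s ℕ.+ y ℕ.* c) ℕ.* b ≡ x ℕ.+ s ℕ.* b ℕ.+ y ℕ.* (b ℕ.* c)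
  lemma = ℕSolver.solve-∀

value-< : ∀ {b} (xs : Vec (Digit b) n) → value xs < b ^ n
value-< []                  = ℕ.≤-refl
value-< {suc n} {b} (x ∷ xs) = begin-strict
  toℕ x ℕ.+ value xs ℕ.* b    <⟨ ℕ.+-monoˡ-< (value xs ℕ.* b) (Fin.toℕ<n x) ⟩
  b ℕ.+ value xs ℕ.* b        ≤⟨ ℕ.*-monoˡ-≤ b (value-< xs) ⟩
  b ^ n ℕ.* b                 ≡⟨ ℕ.*-comm (b ^ n) b ⟩
  b ℕ.* b ^ n                 ∎
  where open ℕ.≤-Reasoning

-- The outermost digit counts at the lowest and at the highest place. Removing both leaves a
-- palindrome shifted by one place, hence the factor `b`. For odd `d` the middle digit counts once.
weights : (b d : ℕ) → Vec ℤ ⌈ d /2⌉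
weights b zero          = []
weights b (suc zero)    = 1ℤ ∷ []
weights b (suc (suc d)) = + (1 ℕ.+ b ^ suc d) ∷ scale (+ b) (weights b d)

digitBox : (b m : ℕ) → Box m
digitBox b m = replicate m (0ℤ , + (b ℕ.∸ 1))

-- By symmetry the first half digit is also the leading digit, so its range starts at 1.
leadingDigitBox : (b m : ℕ) → Box m
leadingDigitBox b zero    = []
leadingDigitBox b (suc m) = (1ℤ , + (b ℕ.∸ 1)) ∷ digitBox b m

toℕ≤pred : ∀ {b} (x : Fin b) → toℕ x ≤ b ℕ.∸ 1
toℕ≤pred {suc b} x = ℕ.≤-pred (Fin.toℕ<n x)

symmetric-value : ∀ b x s c → x ℕ.+ (s ℕ.+ x ℕ.* c) ℕ.* b ≡ (1 ℕ.+ b ℕ.* c) ℕ.* x ℕ.+ b ℕ.* s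
symmetric-value = ℕSolver.solve-∀

-- In `symmetric-value` the variable `s` is the value of the inner digits and `c` is `b ^ d`, so
-- that `1 + b * c` is the first weight.
outer : ∀ {b} d (x : Digit b) (xs : Vec (Digit b) d) (v : Vec ℤ ⌈ d /2⌉) →
        + value xs ≡ weights b d ∙ v → + value (x ∷ (xs ∷ʳ x)) ≡ weights b (2 ℕ.+ d) ∙ (+ toℕ x ∷ v)
outer {b} d x xs v eq = begin
  + (toℕ x ℕ.+ value (xs ∷ʳ x) ℕ.* b)
    ≡⟨ cong (λ s → + (toℕ x ℕ.+ s ℕ.* b)) (value-∷ʳ xs x) ⟩
  + (toℕ x ℕ.+ (value xs ℕ.+ toℕ x ℕ.* b ^ d) ℕ.* b)
    ≡⟨ cong +_ (symmetric-value b (toℕ x) (value xs) (b ^ d)) ⟩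
  + (w ℕ.* toℕ x ℕ.+ b ℕ.* value xs)
    ≡⟨ ℤ.pos-+ (w ℕ.* toℕ x) (b ℕ.* value xs) ⟩
  + (w ℕ.* toℕ x) + + (b ℕ.* value xs)
    ≡⟨ cong₂ _+_ (ℤ.pos-* w (toℕ x)) (ℤ.pos-* b (value xs)) ⟩
  + w * + toℕ x + + b * + value xs
    ≡⟨ cong (λ s → + w * + toℕ x + s) (trans (cong (λ s → + b * s) eq) (sym (scale-∙ (+ b) (weights b d) v))) ⟩
  + w * + toℕ x + scale (+ b) (weights b d) ∙ v
    ∎
  where
  open ≡-Reasoning
  w = 1 ℕ.+ b ^ suc d

halfDigits : ∀ {b} d (xs : Vec (Digit b) d) → IsSymmetric xs →
             ∃[ v ] (v ∈ᴮ digitBox b ⌈ d /2⌉ × + value xs ≡ weights b d ∙ v)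
halfDigits zero       []       _ = [] , [] , refl
halfDigits (suc zero) (x ∷ []) _ =
  (+ toℕ x ∷ []) , ((ℤ.+≤+ ℕ.z≤n , ℤ.+≤+ (toℕ≤pred x)) ∷ []) ,
  trans (cong +_ (ℕ.+-identityʳ (toℕ x))) (lemma (+ toℕ x))
  where
  lemma : ∀ x → x ≡ 1ℤ ℤ.* x ℤ.+ 0ℤ
  lemma = ℤSolver.solve-∀
halfDigits (suc (suc d)) (x ∷ xs) sym-xs with initLast xs
... | ys , y , refl with symmetric-last ys sym-xs
... | refl with halfDigits d ys (symmetric-inner ys sym-xs)
... | v , v∈B , eq =
  (+ toℕ x ∷ v) , ((ℤ.+≤+ ℕ.z≤n , ℤ.+≤+ (toℕ≤pred x)) ∷ v∈B) , outer d x ys v eq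

module _ {d b N : ℕ} where

  palindrome-half : IsPalindrome (suc (suc d)) b N →
                    ∃[ v ] (v ∈ᴮ leadingDigitBox b ⌈ suc (suc d) /2⌉ × + N ≡ weights b (suc (suc d)) ∙ v)
  palindrome-half
    (record { digits = x ∷ xs; expansion = refl; last = last; last-index = last-index; leading≢0 = leading≢0 } ,
     sym-xs)
    with initLast xs
  ... | ys , y , refl with symmetric-last ys sym-xs
  ... | refl with halfDigits d ys (symmetric-inner ys sym-xs)
  ... | v , v∈B , eq =
    (+ toℕ x ∷ v) , ((ℤ.+≤+ (ℕ.n≢0⇒n>0 x≢0) , ℤ.+≤+ (toℕ≤pred x)) ∷ v∈B) , outer d x ys v eq
    where
    last≡ : last ≡ fromℕ (suc d)
    last≡ = Fin.toℕ-injective (trans (ℕ.suc-injective last-index) (sym (Fin.toℕ-fromℕ (suc d))))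
    -- Symmetry has already identified the leading digit with the units digit `x`.
    x≢0 : toℕ x ≢ 0
    x≢0 x≡0 = leading≢0 (trans (cong toℕ (trans (cong (lookup (x ∷ (ys ∷ʳ x))) last≡) (lookup-∷ʳ-fromℕ ys x))) x≡0)

  palindrome-< : IsPalindrome d b N → N < b ^ d
  palindrome-< (record { digits = xs; expansion = refl } , _) = value-< xs

  palindrome-≥ : IsPalindrome (suc d) b N → b ^ d ≤ N
  palindrome-≥
    (record { digits = xs; expansion = refl; last = last; last-index = last-index; leading≢0 = leading≢0 } , _)
    with initLast xs
  ... | ys , y , refl = begin
    b ^ d                            ≡⟨ ℕ.*-identityˡ (b ^ d) ⟨
    1 ℕ.* b ^ d                      ≤⟨ ℕ.*-monoˡ-≤ (b ^ d) (ℕ.n≢0⇒n>0 y≢0) ⟩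
    toℕ y ℕ.* b ^ d                  ≤⟨ ℕ.m≤n+m _ (value ys) ⟩
    value ys ℕ.+ toℕ y ℕ.* b ^ d     ≡⟨ value-∷ʳ ys y ⟨
    value (ys ∷ʳ y)                  ∎
    where
    open ℕ.≤-Reasoning
    last≡ : last ≡ fromℕ d
    last≡ = Fin.toℕ-injective (trans (ℕ.suc-injective last-index) (sym (Fin.toℕ-fromℕ d)))
    y≢0 : toℕ y ≢ 0
    y≢0 y≡0 = leading≢0 (trans (cong toℕ (trans (cong (lookup (ys ∷ʳ y)) last≡) (lookup-∷ʳ-fromℕ ys y))) y≡0)

-- The hyperplane and the box of a pair of bases

equation numberForm : (b d : ℕ) → Vec ℤ (⌈ d /2⌉ ℕ.+ ⌈ d /2⌉)
equation   b d = weights 10 d Vec.++ scale (- 1ℤ) (weights b d)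
numberForm b d = weights 10 d Vec.++ replicate ⌈ d /2⌉ 0ℤ

tightenBy : ℕ → Vec ℤ n → Box n → Box n
tightenBy zero    f B = B
tightenBy (suc k) f B = tightenBy k f (tighten f B)

∈-tightenBy : ∀ k (f : Vec ℤ n) {v B} → v ∈ᴮ B → f ∙ v ≡ 0ℤ → v ∈ᴮ tightenBy k f B
∈-tightenBy zero    f v∈B eq = v∈B
∈-tightenBy (suc k) f v∈B eq = ∈-tightenBy k f (∈-tighten f v∈B eq) eq

-- When `10 ^ d` and `b ^ d` differ by nearly a factor of 10, the common range of the two sorts of
-- palindromes is short and tightening fixes outer digits. For `d = 10` and `b = 8`, where
-- `10 ^ 9 < N < 8 ^ 10`, the decimal half starts with 1, 0 and the octal half with 7.
box : (rounds b d : ℕ) → Box (⌈ d /2⌉ ℕ.+ ⌈ d /2⌉)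
box rounds b d = tightenBy rounds (equation b d) (leadingDigitBox 10 ⌈ d /2⌉ Vec.++ leadingDigitBox b ⌈ d /2⌉)

-- Search strategies

record Strategy (n : ℕ) : Set where
  constructor strategy
  field
    exponent : ℕ
    levels   : List (Level n)
    final    : Level n

-- The tree starts with `f` and its value 0 already known, so a rule can add a multiple of `f`. This
-- amounts to changing the correction of the new form for that rule alone.
search : (ℤ → Bool) → Vec ℤ n → Box n → Strategy n → Bool
search leaf f B (strategy k Ls L′) = run leaf (compile (10 ^ k) {{ℕ.m^n≢0 10 k}} f B (f ∷ []) Ls L′) (0ℤ ∷ [])

search-sound : ∀ leaf f B (S : Strategy n) {v} → v ∈ᴮ B → f ∙ v ≡ 0ℤ → T (search leaf f B S) →
               T (leaf (Level.form (Strategy.final S) ∙ v))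
search-sound leaf f B (strategy k Ls L′) v∈B eq =
  compile-sound (10 ^ k) {{ℕ.m^n≢0 10 k}} f B v∈B eq leaf Ls L′
    (trans eq (sym (ℤ.*-zeroʳ (+ (10 ^ k)))) ∷ [])

unit : Fin n → Vec ℤ n
unit i = replicate _ 0ℤ [ i ]≔ 1ℤ

sign : ℤ → ℤ
sign (+ _)    = 1ℤ
sign -[1+ _ ] = - 1ℤ

-- The first rule is the bound given by the box, the second is f ∙ v = 0 with the earlier digits
-- substituted.
digitLevels : Vec ℤ n → List (Fin n) → List (Fin n) → List (Level n)
digitLevels f known []       = []
digitLevels f known (i ∷ is) =
  level (unit i) 0ℤ
    ( (0 , [])
    ∷ (∣ lookup f i ∣ ℕ.∸ 1 , List.map (λ j → s * lookup f j) known ++ (- s ∷ []))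
    ∷ [])
  ∷ digitLevels f (i ∷ known) is
  where
  s = sign (lookup f i)

-- Decimal and base `b` digits alternate, outermost first: these have the largest coefficients, so
-- fixing them confines the remaining ones most. The final rule combines to the zero form, whose
-- range is a point; thus the digits determine the one value of `N` that is tested.
digitStrategy : ∀ m → (f g : Vec ℤ (m ℕ.+ m)) → Strategy (m ℕ.+ m)
digitStrategy m f g = strategy 0 (digitLevels f [] digits)
  (level g 0ℤ ((0 , List.map (λ j → - lookup g j) (List.reverse digits)) ∷ []))
  where
  digits = List.concatMap (λ i → (i ↑ˡ m) ∷ (m ↑ʳ i) ∷ []) (List.allFin m)

-- With Q = 10 ^ exponent, the level (τ , h , codes) has the form τ f / Q rounded coordinatewise.
-- Each code lists a rule by its digits in base 2 h + 1, least significant first: the multiplier of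
-- the new form less 1, and then, increased by h, the multipliers of the earlier forms, latest
-- first, and of f.  Up to a form in the digits fixed by the box, Q N is the combination of the
-- reduced forms with multipliers final, latest first, less offset times f.
record Certificate : Set where
  constructor certificate
  field
    exponent : ℕ
    levels   : List (ℕ × ℕ × List ℕ)
    final    : List ℕ
    offset   : ℤ

unpack : (half count code : ℕ) → List ℤ
unpack half zero        code = []
unpack half (suc count) code =
  (code ℕ.% suc (2 ℕ.* half)) ℤ.⊖ half ∷ unpack half count (code ℕ./ suc (2 ℕ.* half))

-- Adding half of `Q = 10 ^ k` before rounding down rounds to the nearest integer. Hence the
-- coefficients of the reduced form are at most `Q / 2` in absolute value, and `τ` alone encodes the
-- form. The argument `count` is the number of known forms, including `f`.
certifiedLevels : ℕ → Vec ℤ n → ℕ → List (ℕ × ℕ × List ℕ) → List (Level n)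
certifiedLevels k f count []                       = []
certifiedLevels k f count ((τ , half , codes) ∷ Ls) =
  level (Vec.map (λ a → ⌊ + (2 ℕ.* τ) * a + + (10 ^ k) / 2 ℕ.* 10 ^ k ⌋) f) (+ τ)
    (List.map (λ code → code ℕ.% suc (2 ℕ.* half) , unpack half count (code ℕ./ suc (2 ℕ.* half)))
      codes)
  ∷ certifiedLevels k f (suc count) Ls
  where
  instance
    _ = ℕ.m*n≢0 2 (10 ^ k) {{_}} {{ℕ.m^n≢0 10 k}}

-- With suitable `final` and `offset` the combination is constant on the box, so each branch leaves
-- at most one `N`. With `final` empty and `offset` 0 only the range of `N` over the box remains;
-- certificates of this sort are given where no branch reaches a leaf.
certifiedStrategy : (f g : Vec ℤ n) → Certificate → Strategy n
certifiedStrategy f g (certificate k Ls final offset) = strategy k (certifiedLevels k f 1 Ls)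
  (level g 0ℤ ((0 , List.map (λ c → - (+ c)) final ++ (offset ∷ [])) ∷ []))

-- Checking the entries of the table

-- An entry is (d , b , N), where b is one of the bases that witness N.
Entry : Set
Entry = ℕ × ℕ × ℕ

dimension : Entry → ℕ
dimension (d , _ , _) = d

member : Entry → ℕ
member (_ , _ , N) = N

-- Whatever does not fit into `d` digits is dropped. That `N` has exactly `d` digits is tested in
-- `palindrome?`, by recomputing the value and inspecting the leading digit.
digitsOf : ∀ b .{{_ : NonZero b}} d → ℕ → Vec (Digit b) d
digitsOf b zero    N = []
digitsOf b (suc d) N = N mod b ∷ digitsOf b d (N ℕ./ b)

palindrome? : ∀ d b → .{{_ : NonZero b}} → ∀ N → Maybe (IsPalindrome d b N)
palindrome? zero    b N = nothing
palindrome? (suc d) b N = Maybe.map palindrome (dec⇒maybe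
  (value xs ℕ.≟ N ×-dec ¬? (toℕ (lookup xs (fromℕ d)) ℕ.≟ 0) ×-dec
   Fin.all? (λ k → lookup xs (opposite k) Fin.≟ lookup xs k)))
  where
  xs = digitsOf b (suc d) N
  palindrome : value xs ≡ N × toℕ (lookup xs (fromℕ d)) ≢ 0 × IsSymmetric xs → IsPalindrome (suc d) b N
  palindrome (eq , ≢0 , sym-xs) =
    record
      { digits     = xs
      ; expansion  = eq
      ; last       = fromℕ d
      ; last-index = cong suc (Fin.toℕ-fromℕ d)
      ; leading≢0  = ≢0
      } , sym-xs

doublePalindrome? : (e : Entry) → Maybe (IsDoublePalindrome (dimension e) (member e))
doublePalindrome? (d , zero , N)      = nothing
doublePalindrome? (d , b@(suc _) , N) =
  Maybe.zipWith (λ (0<N , 2≤d , 2≤b , b≢10) (p , q) → 0<N , 2≤d , p , b , 2≤b , b≢10 , q)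
    (dec⇒maybe (0 ℕ.<? N ×-dec 2 ℕ.≤? d ×-dec 2 ℕ.≤? b ×-dec ¬? (b ℕ.≟ 10)))
    (Maybe.zip (palindrome? d 10 N) (palindrome? d b N))

-- The default has no levels, so for a pair without certificate the check would sweep the whole
-- range of `N` over the box. A gap in the data can make the check fail but cannot make it unsound.
findCertificate : ℕ → ℕ → List (ℕ × ℕ × Certificate) → Certificate
findCertificate d b []                     = certificate 0 [] [] 0ℤ
findCertificate d b ((d′ , b′ , C) ∷ Cs) =
  if (d ≡ᵇ d′) ∧ (b ≡ᵇ b′) then C else findCertificate d b Cs

-- Bounds on the base and on the number of digits

feasible : ℕ → ℕ → Bool
feasible d b = (10 ^ (d ℕ.∸ 1) <ᵇ b ^ d) ∧ (b ^ (d ℕ.∸ 1) <ᵇ 10 ^ d) ∧ not (b ≡ᵇ 10)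

-- The lower bound for `N` in each base is chained with the upper bound in the other.
palindromes-feasible : ∀ {d b N} → b ≢ 10 → IsPalindrome (suc d) 10 N → IsPalindrome (suc d) b N →
                       T (feasible (suc d) b)
palindromes-feasible {d} {b} b≢10 p q = Equivalence.from T-∧
  ( ℕ.<⇒<ᵇ (ℕ.≤-<-trans (palindrome-≥ p) (palindrome-< q))
  , Equivalence.from T-∧
    ( ℕ.<⇒<ᵇ (ℕ.≤-<-trans (palindrome-≥ q) (palindrome-< p))
    , not-≡ᵇ b 10 b≢10))
  where
  not-≡ᵇ : ∀ m n → m ≢ n → T (not (m ≡ᵇ n))
  not-≡ᵇ m n m≢n with m ≡ᵇ n in eq
  ... | true  = m≢n (ℕ.≡ᵇ⇒≡ m n (subst T (sym eq) tt))
  ... | false = tt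

-- For `b ≥ 100` and `d ≥ 1`, `b ^ d` is at least `10 ^ (2 d)`, hence at least `10 ^ (d + 1)`. Here
-- `d` is one less than the number of digits. The bound is crude: it only makes the list of bases
-- finite, and `feasible` does the actual selection.
base-< : ∀ {d b} → 1 ≤ d → b ^ d < 10 ^ suc d → b < 100
base-< {d} {b} 1≤d h = ℕ.≰⇒> λ 100≤b → ℕ.<⇒≱ h (begin
  10 ^ suc d            ≤⟨ ℕ.^-monoʳ-≤ 10 (ℕ.+-monoˡ-≤ d 1≤d) ⟩
  10 ^ (d ℕ.+ d)        ≡⟨ ℕ.^-distribˡ-+-* 10 d d ⟩
  10 ^ d ℕ.* 10 ^ d     ≡⟨ ^-distribʳ-* 10 10 d ⟨
  100 ^ d               ≤⟨ ℕ.^-monoˡ-≤ d 100≤b ⟩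
  b ^ d                 ∎)
  where
  open ℕ.≤-Reasoning
  rearrange : ∀ x y z w → x ℕ.* y ℕ.* (z ℕ.* w) ≡ x ℕ.* z ℕ.* (y ℕ.* w)
  rearrange = ℕSolver.solve-∀
  ^-distribʳ-* : ∀ x y k → (x ℕ.* y) ^ k ≡ x ^ k ℕ.* y ^ k
  ^-distribʳ-* x y zero    = refl
  ^-distribʳ-* x y (suc k) = trans (cong (x ℕ.* y ℕ.*_) (^-distribʳ-* x y k)) (rearrange x y (x ^ k) (y ^ k))

-- Passing from `m` to `m + 1` multiplies the left side by `a` and the right side by `b ≥ a`, so one
-- numerical instance settles all larger exponents.
^-gap : ∀ {a b m d} → a ≤ b → m ≤ d → a ^ suc m ≤ b ^ m → a ^ suc d ≤ b ^ d
^-gap {a} {b} {m} a≤b m≤d h with ℕ.m≤n⇒∃[o]m+o≡n m≤d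
... | k , refl = begin
  a ^ suc (m ℕ.+ k)      ≡⟨ ℕ.^-distribˡ-+-* a (suc m) k ⟩
  a ^ suc m ℕ.* a ^ k    ≤⟨ ℕ.*-mono-≤ h (ℕ.^-monoˡ-≤ k a≤b) ⟩
  b ^ m ℕ.* b ^ k        ≡⟨ ℕ.^-distribˡ-+-* b m k ⟨
  b ^ (m ℕ.+ k)          ∎
  where open ℕ.≤-Reasoning

-- Only the neighbours 9 and 11 of 10 need a computation, as other bases are farther away. The
-- constant is sharp: `11 ^ 24 < 10 ^ 25`, while `10 ^ 26 ≤ 11 ^ 25`. Again `d` is one less than the
-- number of digits, so 25 digits remain possible.
dimension-< : ∀ {d b} → b ≢ 10 → b ^ d < 10 ^ suc d → 10 ^ d < b ^ suc d → d < 25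
dimension-< {d} {b} b≢10 h₁ h₂ = ℕ.≰⇒> absurd
  where
  absurd : ¬ (25 ≤ d)
  absurd 25≤d with ℕ.<-cmp b 10
  ... | tri< b<10 _ _ = ℕ.<⇒≱ h₂ (ℕ.≤-trans (ℕ.^-monoˡ-≤ (suc d) (ℕ.≤-pred b<10))
                          (^-gap (ℕ.n≤1+n 9) 25≤d (ℕ.≤ᵇ⇒≤ (9 ^ 26) (10 ^ 25) tt)))
  ... | tri≈ _ b≡10 _ = b≢10 b≡10
  ... | tri> _ _ 10<b = ℕ.<⇒≱ h₁ (ℕ.≤-trans (^-gap (ℕ.n≤1+n 10) 25≤d (ℕ.≤ᵇ⇒≤ (10 ^ 26) (11 ^ 25) tt))
                          (ℕ.^-monoˡ-≤ d 10<b))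

-- Completeness from the Boolean check

Lists : ℕ → ℕ → Entry → Set
Lists d N e = d ≡ dimension e × N ≡ member e

-- The search yields integers, the table holds naturals. Taking absolute values is harmless, since
-- soundness is applied at `c = + N` only.
matches : ℕ → ℤ → Entry → Bool
matches d c e = (d ≡ᵇ dimension e) ∧ (∣ c ∣ ≡ᵇ member e)

matches-sound : ∀ d N e → T (matches d (+ N) e) → Lists d N e
matches-sound d N e h with Equivalence.to (T-∧ {d ≡ᵇ dimension e}) h
... | h₁ , h₂ = ℕ.≡ᵇ⇒≡ d (dimension e) h₁ , ℕ.≡ᵇ⇒≡ N (member e) h₂

module _ (entries : List Entry) (certificates : List (ℕ × ℕ × Certificate)) (rounds : ℕ) where

  listed : ℕ → ℤ → Bool
  listed d c = any (matches d c) entries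

  strategyFor : ∀ b d → Strategy (⌈ d /2⌉ ℕ.+ ⌈ d /2⌉)
  strategyFor b d =
    if d <ᵇ 9 then digitStrategy ⌈ d /2⌉ (equation b d) (numberForm b d)
    else certifiedStrategy (equation b d) (numberForm b d) (findCertificate d b certificates)

  verified : ℕ → ℕ → Bool
  verified d b = if feasible d b then search (listed d) (equation b d) (box rounds b d) (strategyFor b d) else true

  final-form : ∀ b d → Level.form (Strategy.final (strategyFor b d)) ≡ numberForm b d
  final-form b d with d <ᵇ 9
  ... | true  = refl
  ... | false = refl

  listed-sound : ∀ d N → T (listed d (+ N)) → Any (Lists d N) entries
  listed-sound d N h = Any.map (λ {e} → matches-sound d N e) (any⁻ (matches d (+ N)) entries h)

  searched : ∀ d b → T (feasible d b) → T (verified d b) →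
             T (search (listed d) (equation b d) (box rounds b d) (strategyFor b d))
  searched d b h₁ h₂ with feasible d b
  ... | true = h₂

  -- The index `e` stands for `2 + e` digits, so this covers 2 to 25 digits and all bases below 100,
  -- as `dimension-<` and `base-<` require.
  module _ (allVerified : all (λ e → all (λ b → verified (2 ℕ.+ e) b) (upTo 100)) (upTo 24) ≡ true) where

    allVerified-lookup : ∀ d b → d < 24 → b < 100 → T (verified (2 ℕ.+ d) b)
    allVerified-lookup d b d<24 b<100 =
      All.lookup (all⁺ (λ b → verified (2 ℕ.+ d) b) (upTo 100)
        (All.lookup (all⁺ (λ e → all (λ b → verified (2 ℕ.+ e) b) (upTo 100)) (upTo 24)
          (Equivalence.from T-≡ allVerified)) (∈-upTo⁺ d<24)))
        (∈-upTo⁺ b<100)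

    complete : ∀ {d N} → IsDoublePalindrome d N → Any (Lists d N) entries
    complete {suc zero} (_ , s≤s () , _)
    complete {D@(suc (suc d))} {N} (_ , _ , p , b , _ , b≢10 , q) =
      listed-sound D N (subst (λ c → T (listed D c)) number≡
        (search-sound (listed D) f (box rounds b D) (strategyFor b D) v∈box fv≡0
          (searched D b (palindromes-feasible b≢10 p q) verified-b)))
      where
      f = equation b D
      h₁ = ℕ.≤-<-trans (palindrome-≥ q) (palindrome-< p)
      h₂ = ℕ.≤-<-trans (palindrome-≥ p) (palindrome-< q)
      verified-b : T (verified D b)
      verified-b = allVerified-lookup d b
        -- Both bounds are applied to `suc d`, one less than the number `D` of digits.
        (ℕ.≤-pred (dimension-< {suc d} b≢10 h₁ h₂)) (base-< {suc d} (s≤s z≤n) h₁)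
      x = proj₁ (palindrome-half p)
      y = proj₁ (palindrome-half q)
      x∈box = proj₁ (proj₂ (palindrome-half p))
      y∈box = proj₁ (proj₂ (palindrome-half q))
      N≡x = proj₂ (proj₂ (palindrome-half p))
      N≡y = proj₂ (proj₂ (palindrome-half q))
      v = x Vec.++ y
      open ≡-Reasoning
      fv≡0 : f ∙ v ≡ 0ℤ
      fv≡0 = begin
        f ∙ v                                               ≡⟨ ++-∙ (weights 10 D) x (scale (- 1ℤ) (weights b D)) y ⟩
        weights 10 D ∙ x + scale (- 1ℤ) (weights b D) ∙ y   ≡⟨ cong₂ _+_ (sym N≡x) (scale-∙ (- 1ℤ) (weights b D) y) ⟩
        + N + - 1ℤ * (weights b D ∙ y)                      ≡⟨ cong (λ z → + N + - 1ℤ * z) N≡y ⟨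
        + N + - 1ℤ * + N                                    ≡⟨ cong (λ z → + N + z) (ℤ.-1*i≡-i (+ N)) ⟩
        + N - + N                                           ≡⟨ ℤ.+-inverseʳ (+ N) ⟩
        0ℤ                                                  ∎
      v∈box : v ∈ᴮ box rounds b D
      v∈box = ∈-tightenBy rounds f (++⁺ x∈box y∈box) fv≡0
      number≡ : Level.form (Strategy.final (strategyFor b D)) ∙ v ≡ + N
      number≡ = begin
        Level.form (Strategy.final (strategyFor b D)) ∙ v   ≡⟨ cong (_∙ v) (final-form b D) ⟩
        numberForm b D ∙ v                                  ≡⟨ ++-∙ (weights 10 D) x (replicate ⌈ D /2⌉ 0ℤ) y ⟩
        weights 10 D ∙ x + replicate ⌈ D /2⌉ 0ℤ ∙ y         ≡⟨ cong₂ _+_ (sym N≡x) (0-∙ y) ⟩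
        + N + 0ℤ                                            ≡⟨ ℤ.+-identityʳ (+ N) ⟩
        + N                                                 ∎

sound : ∀ es → all (λ e → is-just (doublePalindrome? e)) es ≡ true →
        ∀ {e} → e ∈ es → IsDoublePalindrome (dimension e) (member e)
sound es eq {e} e∈ = to-witness-T (doublePalindrome? e)
  (All.lookup (all⁺ (λ e → is-just (doublePalindrome? e)) es (Equivalence.from T-≡ eq)) e∈)

-- The table and the certificates

-- One base per number is enough: the search at any base compares only the number of digits and `N`.
-- For instance 99 is 33 in base 32 and 11 in base 98, and has a single entry.
entries : List Entry
entries =
  (2 , 21 , 22) ∷ (2 , 32 , 33) ∷ (2 , 21 , 44) ∷ (2 , 54 , 55) ∷ (2 , 21 , 66) ∷ (2 , 76 , 77) ∷
  (2 , 21 , 88) ∷ (2 , 32 , 99) ∷ (3 , 6 , 111) ∷ (3 , 7 , 121) ∷ (3 , 6 , 141) ∷ (3 , 7 , 171) ∷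
  (3 , 12 , 181) ∷ (3 , 6 , 191) ∷ (3 , 13 , 222) ∷ (3 , 11 , 232) ∷ (3 , 7 , 242) ∷
  (3 , 9 , 282) ∷ (3 , 7 , 292) ∷ (3 , 13 , 313) ∷ (3 , 14 , 323) ∷ (3 , 8 , 333) ∷
  (3 , 11 , 343) ∷ (3 , 13 , 353) ∷ (3 , 8 , 373) ∷ (3 , 8 , 414) ∷ (3 , 13 , 444) ∷
  (3 , 11 , 454) ∷ (3 , 9 , 464) ∷ (3 , 21 , 484) ∷ (3 , 17 , 494) ∷ (3 , 18 , 505) ∷
  (3 , 17 , 545) ∷ (3 , 9 , 555) ∷ (3 , 11 , 565) ∷ (3 , 13 , 575) ∷ (3 , 18 , 595) ∷
  (3 , 12 , 616) ∷ (3 , 16 , 626) ∷ (3 , 9 , 646) ∷ (3 , 9 , 656) ∷ (3 , 13 , 666) ∷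
  (3 , 11 , 676) ∷ (3 , 18 , 686) ∷ (3 , 14 , 717) ∷ (3 , 22 , 727) ∷ (3 , 12 , 737) ∷
  (3 , 21 , 757) ∷ (3 , 17 , 767) ∷ (3 , 11 , 787) ∷ (3 , 12 , 797) ∷ (3 , 17 , 818) ∷
  (3 , 15 , 828) ∷ (3 , 19 , 838) ∷ (3 , 18 , 848) ∷ (3 , 14 , 858) ∷ (3 , 15 , 888) ∷
  (3 , 11 , 898) ∷ (3 , 11 , 909) ∷ (3 , 15 , 919) ∷ (3 , 29 , 929) ∷ (3 , 15 , 949) ∷
  (3 , 15 , 979) ∷ (3 , 17 , 989) ∷ (3 , 14 , 999) ∷ (4 , 8 , 3663) ∷ (4 , 13 , 6776) ∷
  (4 , 12 , 8008) ∷ (4 , 13 , 8778) ∷ (5 , 8 , 13131) ∷ (5 , 8 , 13331) ∷ (5 , 7 , 16561) ∷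
  (5 , 9 , 25752) ∷ (5 , 8 , 26462) ∷ (5 , 8 , 26662) ∷ (5 , 11 , 26962) ∷ (5 , 9 , 27472) ∷
  (5 , 8 , 30103) ∷ (5 , 8 , 30303) ∷ (5 , 12 , 35953) ∷ (5 , 11 , 38183) ∷ (5 , 14 , 39593) ∷
  (5 , 11 , 40504) ∷ (5 , 9 , 42324) ∷ (5 , 12 , 43934) ∷ (5 , 11 , 49294) ∷ (5 , 9 , 50605) ∷
  (5 , 11 , 52825) ∷ (5 , 13 , 56265) ∷ (5 , 14 , 59095) ∷ (5 , 15 , 60106) ∷ (5 , 11 , 63936) ∷
  (5 , 15 , 67576) ∷ (5 , 11 , 75157) ∷ (5 , 12 , 88888) ∷ (5 , 16 , 90209) ∷ (5 , 16 , 94049) ∷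
  (5 , 17 , 94249) ∷ (5 , 16 , 96369) ∷ (5 , 16 , 98689) ∷ (6 , 8 , 207702) ∷ (6 , 14 , 546645) ∷
  (6 , 12 , 646646) ∷ (7 , 8 , 1496941) ∷ (7 , 9 , 1540451) ∷ (7 , 9 , 1713171) ∷
  (7 , 9 , 1721271) ∷ (7 , 9 , 1828281) ∷ (7 , 9 , 1877781) ∷ (7 , 9 , 1885881) ∷
  (7 , 8 , 1935391) ∷ (7 , 8 , 1970791) ∷ (7 , 9 , 2401042) ∷ (7 , 9 , 2434342) ∷
  (7 , 9 , 2442442) ∷ (7 , 9 , 2450542) ∷ (7 , 11 , 2956592) ∷ (7 , 11 , 2968692) ∷
  (7 , 9 , 3106013) ∷ (7 , 9 , 3114113) ∷ (7 , 9 , 3122213) ∷ (7 , 9 , 3163613) ∷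
  (7 , 9 , 3171713) ∷ (7 , 12 , 3192913) ∷ (7 , 11 , 3262623) ∷ (7 , 11 , 3274723) ∷
  (7 , 11 , 3286823) ∷ (7 , 11 , 3298923) ∷ (7 , 9 , 3303033) ∷ (7 , 9 , 3360633) ∷
  (7 , 11 , 3372733) ∷ (7 , 11 , 4348434) ∷ (7 , 11 , 4410144) ∷ (7 , 11 , 4422244) ∷
  (7 , 11 , 4581854) ∷ (7 , 11 , 4593954) ∷ (7 , 12 , 5641465) ∷ (7 , 11 , 5643465) ∷
  (7 , 11 , 5655565) ∷ (7 , 11 , 5667665) ∷ (7 , 11 , 5741475) ∷ (7 , 11 , 7280827) ∷
  (7 , 11 , 7292927) ∷ (7 , 12 , 8364638) ∷ (7 , 11 , 8710178) ∷ (7 , 11 , 8722278) ∷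
  (7 , 11 , 8734378) ∷ (7 , 11 , 8746478) ∷ (7 , 11 , 8758578) ∷ (7 , 11 , 8820288) ∷
  (7 , 11 , 8832388) ∷ (7 , 11 , 8844488) ∷ (7 , 13 , 8864688) ∷ (7 , 14 , 9046409) ∷
  (7 , 14 , 9578759) ∷ (7 , 14 , 9813189) ∷ (7 , 12 , 9963699) ∷ (9 , 8 , 130535031) ∷
  (9 , 9 , 167191761) ∷ (9 , 9 , 181434181) ∷ (9 , 9 , 232000232) ∷ (9 , 11 , 356777653) ∷
  (9 , 11 , 362151263) ∷ (9 , 9 , 382000283) ∷ (9 , 11 , 489525984) ∷ (9 , 11 , 492080294) ∷
  (9 , 12 , 520020025) ∷ (9 , 11 , 537181735) ∷ (9 , 12 , 713171317) ∷ (9 , 12 , 796212697) ∷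
  (9 , 13 , 952404259) ∷ (9 , 11 , 998111899) ∷ (9 , 11 , 999454999) ∷ (11 , 11 , 39276067293) ∷
  (11 , 11 , 39453235493) ∷ (11 , 11 , 42521012524) ∷ (11 , 12 , 73183838137) ∷
  (13 , 9 , 1400232320041) ∷ (13 , 9 , 2005542455002) ∷ (13 , 9 , 2024099904202) ∷
  (13 , 9 , 2081985891802) ∷ (13 , 11 , 4798641468974) ∷ (15 , 9 , 101904010409101) ∷
  (15 , 9 , 149285434582941) ∷ (15 , 9 , 149819212918941) ∷ (15 , 11 , 463906656609364) ∷
  (17 , 9 , 11111059395011111) ∷ (17 , 9 , 11199701210799111) ∷ (17 , 9 , 13577478487477531) ∷
  (17 , 9 , 14802554345520841) ∷ (17 , 11 , 54470642224607445) ∷ (17 , 11 , 56681764446718665) ∷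
  (17 , 11 , 56831729892713865) ∷ (17 , 11 , 62712119691121726) ∷ (17 , 11 , 64224652625642246) ∷
  (19 , 11 , 6411682614162861146) ∷ (19 , 11 , 7861736017106371687) ∷
  (21 , 9 , 104618510424015816401) ∷ (21 , 11 , 686833076121670338686) ∷
  (21 , 11 , 771341832818238143177) ∷ (21 , 11 , 903253059636950352309) ∷
  (23 , 11 , 89403957605050675930498) ∷ (25 , 11 , 9986831781362631871386899) ∷ []

-- Congruences appear here as levels: if `τ / Q` is close to a fraction with denominator `m`, the
-- reduced form sees essentially the residues of the coefficients modulo `m`. For even `d` and
-- `b = 9` or `b = 11` one such level suffices. A palindrome with an even number of digits in base
-- `b` is divisible by `b + 1`. For `b = 9` this gives `10 ∣ N`, against the nonzero last decimal
-- digit; here `τ / Q` is near 1/10 or 9/10. For `b = 11` one uses `11 ∣ N` from the decimal side,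
-- against the nonzero last digit in base 11; here `τ / Q` is near 1/11.
certificates : List (ℕ × ℕ × Certificate)
certificates =
    (9 , 8 ,
    certificate 9
    (  (464604530 , 1 , 6 ∷ [])
    ∷  (250000041 , 5 , 44 ∷ [])
    ∷  (339604065 , 71 , 416637655 ∷ 250019485 ∷ [])
    ∷  (698495110 , 4 , 55854 ∷ [])
    ∷  (499999981 , 8 , 23432545 ∷ [])
    ∷  (915296386 , 97 , 6790639760077291 ∷ 10696777914441844 ∷ 4973755728750317 ∷ [])
    ∷  (340801871 , 9 , 16583679921 ∷ 2289283856 ∷ [])
    ∷  (764396624 , 17 , 30464655528020 ∷ 873843159250 ∷ [])
    ∷ [])
    (1656200 ∷ 6000600 ∷ 6424600 ∷ 31091130 ∷ 1464200 ∷ 253000 ∷ 17534720 ∷ 5051600 ∷ [])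
    -[1+ 297734049 ])
  ∷ (9 , 9 ,
    certificate 10
    (  (220987796 , 5 , 110 ∷ [])
    ∷  (5900000030 , 25 , 131325 ∷ [])
    ∷  (1383951595 , 35 , 8052962 ∷ 159111 ∷ [])
    ∷  (727026303 , 4 , 58033 ∷ [])
    ∷  (2561983483 , 48 , 828407223540 ∷ [])
    ∷  (4099999772 , 1046 , 88898849071958120913900 ∷ 88562789739559438661268 ∷ 175913423853932161373874 ∷ [])
    ∷  (3879012244 , 170 , 128943972186717844002 ∷ 128934529390881431505 ∷ 78018219338602618164 ∷
       104808093678088745473 ∷ 182602315404460231011 ∷ 147708968533184307129 ∷ [])
    ∷  (435935607 , 315 , 15844338653246196755428321 ∷ 6748143335957207392896817 ∷ 10240598037041183407271207 ∷
       12428954213246313915314142 ∷ 13332247995691099244896758 ∷ 7879183304565917457131134 ∷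
       6446593733362416541608058 ∷ 7979673285224017668905046 ∷ [])
    ∷  (4756944339 , 126 , 2073351493954758950100 ∷ 583999540562533162981686 ∷ 312307392552840363179920 ∷ [])
    ∷ [])
    (737100 ∷ 2949300 ∷ 82081181 ∷ 24798520 ∷ 818100 ∷ 6051600 ∷ 7453710 ∷ 152131251 ∷ 45929441 ∷ [])
    -[1+ 7312803719 ])
  ∷ (9 , 11 ,
    certificate 10
    (  (9819008200 , 2 , 0 ∷ [])
    ∷  (3719008252 , 11 , 253 ∷ [])
    ∷  (3186931767 , 4 , 3584 ∷ [])
    ∷  (6961983038 , 4 , 57222 ∷ [])
    ∷  (532076392 , 246 , 10472103992307389 ∷ 1384224245956190 ∷ 15036071442019 ∷ [])
    ∷  (2742975359 , 33 , 2042023315914 ∷ 3659493955925 ∷ 6018243418613 ∷ 3400170374052 ∷ [])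
    ∷  (9913969092 , 54 , 9961120580942356 ∷ 19780666239326075 ∷ [])
    ∷  (7409998523 , 40 , 1017720757893721 ∷ [])
    ∷  (7347915635 , 53 , 195933517177633538776 ∷ 85695337094837157420 ∷ 109302577423119586512 ∷
       88924719678311077787 ∷ 138700418859311007147 ∷ [])
    ∷ [])
    (1343100 ∷ 12343210 ∷ 5373610 ∷ 175030472 ∷ 132748331 ∷ 14909510 ∷ 129929031 ∷ 329524933 ∷ 105141312 ∷ [])
    -[1+ 3411375322 ])
  ∷ (9 , 12 ,
    certificate 10
    (  (8532966510 , 1 , 6 ∷ [])
    ∷  (2229006783 , 4 , 28 ∷ [])
    ∷  (2976931971 , 6 , 27627 ∷ [])
    ∷  (8709010302 , 44 , 218892922 ∷ 39156974 ∷ [])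
    ∷  (9999999981 , 19 , 45112080 ∷ 1905212718 ∷ [])
    ∷  (4008019952 , 22 , 253445274947 ∷ 87394661327 ∷ 369118973299 ∷ [])
    ∷  (4945046043 , 19 , 1303604456349 ∷ 133163108367 ∷ 1953926370595 ∷ [])
    ∷  (5164952845 , 18 , 104383159800707 ∷ 2328053692628 ∷ 33278756263447 ∷ [])
    ∷  (2593070372 , 28 , 3512043723383286 ∷ 137913370955441420 ∷ 187708246143243763 ∷ [])
    ∷ [])
    (211253112 ∷ 149423952 ∷ 37585740 ∷ 19231920 ∷ 313778413 ∷ 164019372 ∷ 98766900 ∷ 23030220 ∷ 151241952 ∷ [])
    -[1+ 366385940 ])
  ∷ (9 , 13 ,
    certificate 10
    (  (7839006117 , 5 , 0 ∷ [])
    ∷  (4587031449 , 23 , 102743 ∷ [])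
    ∷  (1939006073 , 8 , 2448 ∷ [])
    ∷  (5572973436 , 114 , 628460732528 ∷ [])
    ∷  (9839995176 , 61 , 3448751324196 ∷ 1703029175812 ∷ [])
    ∷  (2586040362 , 28 , 975632747260 ∷ 977459672898 ∷ 15322220674 ∷ [])
    ∷  (1590991385 , 66 , 55567637744862615 ∷ 65762961133973744 ∷ 97533255074731469 ∷ [])
    ∷  (7635947315 , 72 , 11235994057907507070 ∷ 99061382774937390 ∷ [])
    ∷ [])
    (29878030 ∷ 36919740 ∷ 52233350 ∷ 73292271 ∷ 76484681 ∷ 7353710 ∷ 54788461 ∷ 64989470 ∷ [])
    -[1+ 5995899470 ])
  -- Here `τ / Q = 1/4`. Modulo 4 only the decimal digits `x₁`, `x₂` and the octal digit `y₁`
  -- survive, in `x₁ + 2 x₂ - y₁`; the box fixes them to 1, 0, 7, and -6 is not divisible by 4.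
  ∷ (10 , 8 ,
    certificate 9
    (  (250000000 , 3 , 24 ∷ [])
    ∷ [])
    [] 0ℤ)
  -- The code 210 is `14 * 15` in base 15, so `f` gets the multiplier `14 - 7 = 7`, which turns
  -- `τ / Q` into exactly 9/10 in this rule.
  ∷ (10 , 9 ,
    certificate 11
    (  (90000000007 , 7 , 210 ∷ [])
    ∷ [])
    [] 0ℤ)
  ∷ (10 , 11 ,
    certificate 11
    (  (9090909088 , 3 , 0 ∷ [])
    ∷ [])
    [] 0ℤ)
  ∷ (10 , 12 ,
    certificate 11
    (  (87820881218 , 6 , 156 ∷ [])
    ∷  (42700902754 , 6 , 78 ∷ [])
    ∷  (47397306251 , 526 , 624071520190 ∷ 542859409 ∷ 607723244505 ∷ [])
    ∷ [])
    [] 0ℤ)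
  ∷ (11 , 9 ,
    certificate 12
    (  (33209876692 , 12 , 600 ∷ [])
    ∷  (490000000039 , 33 , 298485 ∷ [])
    ∷  (872190087306 , 44 , 329033 ∷ 35624475 ∷ [])
    ∷  (537739621639 , 60 , 14687111527 ∷ 12547051440 ∷ 25835544660 ∷ [])
    ∷  (305119784979 , 49 , 537118239043 ∷ 937014357906 ∷ 433754246476 ∷ 565551871137 ∷ [])
    ∷  (106419753889 , 300 , 13642858931541276595 ∷ 23013120779777080 ∷ 13594401580903683002 ∷
       20053595628891714149 ∷ [])
    ∷  (476790123341 , 90 , 1034232631762841804 ∷ 3041306044277761 ∷ [])
    ∷  (787939602022 , 52 , 1011914979789617717 ∷ 1544078955242279404 ∷ [])
    ∷  (594979205157 , 55 , 282686325589360258276 ∷ [])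
    ∷  (113871315875 , 217 , 26564250747708728408350295718 ∷ 105411812372662567952834632800 ∷
       89876987324893301396711416388 ∷ 36997771574411776672178791380 ∷ [])
    ∷ [])
    [] 0ℤ)
  ∷ (11 , 11 ,
    certificate 12
    (  (972809917299 , 4 , 0 ∷ [])
    ∷  (579499950235 , 3 , 14 ∷ [])
    ∷  (403990105952 , 14 , 10500 ∷ 37410 ∷ [])
    ∷  (160390059379 , 18 , 1038405 ∷ [])
    ∷  (974430665294 , 11 , 2098315 ∷ 4931523 ∷ [])
    ∷  (251609848474 , 22 , 119670682818 ∷ 369919599259 ∷ [])
    ∷  (629949499638 , 118 , 5887743268971045895 ∷ 3045633399282889609 ∷ 1446839475160497104 ∷
       4556710246025686961 ∷ 4431596458955599986 ∷ 21691946387643542 ∷ 4220537708193798014 ∷ [])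
    ∷  (462809917342 , 28 , 2939152870813536 ∷ 57670088297223 ∷ 2950881643342577 ∷ 5054489154419493 ∷ [])
    ∷  (638760330725 , 40 , 3986749484202316745 ∷ 7424284397524502051 ∷ 49219990883529845 ∷ [])
    ∷  (643560446539 , 10 , 115146051503472 ∷ 306200177243605 ∷ [])
    ∷  (301208987977 , 40 , 64550528059467641237345 ∷ 68490814184851983574789 ∷ 79177387438418054209264 ∷
       35919376043812280623720 ∷ [])
    ∷ [])
    (177168200 ∷ 1086569110 ∷ 5389999351 ∷ 40688888714 ∷ 1832123810 ∷ 255444310 ∷ 1299300310 ∷ 14990509051 ∷
     13378278431 ∷ 134443100 ∷ 11316361222 ∷ [])
    -[1+ 239517652731 ])
  ∷ (11 , 12 ,
    certificate 12
    (  (157990102391 , 5 , 110 ∷ [])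
    ∷  (934839615600 , 3 , 301 ∷ [])
    ∷  (750819818432 , 4 , 351 ∷ [])
    ∷  (933199976612 , 11 , 115553 ∷ [])
    ∷  (87930702084 , 342 , 49393738348103670 ∷ 64475969193159710 ∷ 103235510320113706 ∷ [])
    ∷  (885219785104 , 132 , 42077649399214956 ∷ 36872412602297946 ∷ 55241669302837020 ∷ 91612900818642089 ∷ [])
    ∷  (456440553457 , 44 , 3914473325768017 ∷ 2543787569672947 ∷ 1173112982393823 ∷ [])
    ∷  (261939597374 , 232 , 772741384085593414342083 ∷ 1015320850571688430248002 ∷ 560679403325121480106681 ∷
       [])
    ∷  (500000000033 , 439 , 148013622768482584776125277288 ∷ 162311154729640946021339554 ∷
       124832297305425326624328467133 ∷ [])
    ∷  (502580236955 , 28 , 20442512770144745647 ∷ 17565186986112926853 ∷ [])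
    ∷ [])
    (225763200 ∷ 19176768192 ∷ 255355200 ∷ 239803200 ∷ 2056965120 ∷ 1685358720 ∷ 3916160940 ∷ 4645855740 ∷
     1347574320 ∷ 6129503160 ∷ [])
    -[1+ 734966841015 ])
  ∷ (12 , 9 ,
    certificate 13
    (  (9000000000008 , 8 , 272 ∷ [])
    ∷ [])
    [] 0ℤ)
  ∷ (12 , 11 ,
    certificate 13
    (  (909090909089 , 2 , 0 ∷ [])
    ∷ [])
    [] 0ℤ)
  ∷ (12 , 12 ,
    certificate 13
    (  (2026263736975 , 1 , 6 ∷ [])
    ∷  (2016154837981 , 5 , 66 ∷ [])
    ∷  (6206900129743 , 11 , 274231 ∷ [])
    ∷  (5051381584944 , 28 , 280293054 ∷ 258807304 ∷ 415503157 ∷ 6200745 ∷ [])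
    ∷  (7370663292626 , 53 , 792310648191 ∷ 834518291055 ∷ 1256333797094 ∷ 1172204840486 ∷ 1493449251480 ∷ [])
    ∷ [])
    [] 0ℤ)
  ∷ (13 , 9 ,
    certificate 14
    (  (98901098901099 , 8 , 0 ∷ [])
    ∷  (96666802333310 , 21 , 903 ∷ [])
    ∷  (39000000000049 , 7 , 1920 ∷ [])
    ∷  (61000000000026 , 75 , 78242783026 ∷ [])
    ∷  (92963098630713 , 24 , 13699694157 ∷ 7220653279 ∷ [])
    ∷  (46669901033343 , 67 , 390853759033538 ∷ 2936387441745 ∷ 226957354577370 ∷ 427261453304720 ∷ [])
    ∷  (6707802192307 , 38 , 826074018289291 ∷ 10536299775234 ∷ 282549266442676 ∷ [])
    ∷  (10188891107999 , 3 , 27252213 ∷ [])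
    ∷  (85985098519421 , 411 , 75090743744787964141760185541 ∷ 82366197699243389760604310898 ∷
       74726861700914606730694469 ∷ [])
    ∷  (48242405767142 , 49 , 45256107705251092454 ∷ 4388043188538029533986 ∷ [])
    ∷  (6534693474284 , 94 , 4736580828158164531108947 ∷ 1160069297868253101640338975 ∷
       1643200736759813976854183614 ∷ [])
    ∷  (50345000446936 , 78 , 4366443159856072693636816905 ∷ 22320435413309748712926228641 ∷
       112141595942702465268467293 ∷ 10676286395491545267674298327 ∷ [])
    ∷  (25641603852480 , 152 , 28366099269663497281531029975001767 ∷ 60180040196244730992318819237247586 ∷
       44968741075193152330476502315074575 ∷ 28760080823756723594997810630398477 ∷
       29158645432084794394694601867067995 ∷ [])
    ∷ [])
    (41898992400 ∷ 190170719920 ∷ 7371737100 ∷ 7306127100 ∷ 218832279220 ∷ 31794882300 ∷ 40410140400 ∷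
     209930290120 ∷ 101667761010 ∷ 407168717041 ∷ 1338909089431 ∷ 209314140120 ∷ 262555442730 ∷ [])
    -[1+ 77795119307784 ])
  ∷ (13 , 11 ,
    certificate 14
    (  (99099099099099 , 2 , 0 ∷ [])
    ∷  (97272801727298 , 5 , 55 ∷ [])
    ∷  (55371900826433 , 12 , 7800 ∷ [])
    ∷  (90076603319008 , 3 , 13062 ∷ [])
    ∷  (18390900905183 , 35 , 65905194638 ∷ 83895948893 ∷ 100136533481 ∷ 45905112907 ∷ 127095085873 ∷ [])
    ∷  (13817703181584 , 40 , 11996195644639 ∷ 10040452362081 ∷ 117022556685 ∷ [])
    ∷  (48256198347146 , 24 , 353241063651 ∷ 13981569344026 ∷ 21306125601721 ∷ 18595492526227 ∷ [])
    ∷  (96592495714311 , 111 , 676021586842380866983 ∷ 1360721470284714732195 ∷ 730593421383559809830 ∷ [])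
    ∷  (70392603805938 , 80 , 5635209861719473810482 ∷ 35864644977477248458 ∷ 6287066072663126188726 ∷
       10784302658503373208778 ∷ 7879836484331452988447 ∷ [])
    ∷  (36500407004361 , 84 , 1415533761972952552187870 ∷ 694797750790460034850890 ∷ 3202460915782540422741501 ∷
       940755022875780363170287 ∷ [])
    ∷  (37512396694352 , 69 , 40277564009146083975474912 ∷ 11067575487604033052728315 ∷
       26395358048302065761366625 ∷ 173760834033730273837478 ∷ [])
    ∷  (3183692617687 , 29 , 72297217283865499421681 ∷ 87886824605976226379540 ∷ 46666739811908860892357 ∷
       104105010579643814603164 ∷ 34935570908920919799182 ∷ [])
    ∷  (13351899855678 , 21 , 58084131887482806426230 ∷ 1259654647209858940321 ∷ 64309429469330229329081 ∷
       72749254522815242226660 ∷ [])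
    ∷ [])
    (6820177100 ∷ 120901991210 ∷ 598289927961 ∷ 19665670200 ∷ 107910088110 ∷ 296303026030 ∷ 1320013100231 ∷
     190373839920 ∷ 162994903610 ∷ 22636462200 ∷ 4489980799954 ∷ 1434927284352 ∷ 1379937210642 ∷ [])
    -[1+ 26155323304823 ])
  ∷ (13 , 12 ,
    certificate 14
    (  (50000000000029 , 29 , 3422 ∷ [])
    ∷  (49999999999914 , 57 , 6670 ∷ [])
    ∷  (89576099424011 , 2 , 60 ∷ [])
    ∷  (60517000284960 , 3 , 4049 ∷ [])
    ∷  (48615900383158 , 4 , 501993 ∷ [])
    ∷  (3060198038667 , 58 , 162865999169758 ∷ 196235612540840 ∷ 1304133390612 ∷ [])
    ∷  (32898000200675 , 17 , 179235526407 ∷ 925489002765 ∷ 811550542006 ∷ [])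
    ∷  (66223395678345 , 92 , 109071415403754437292 ∷ 224384581507480443231 ∷ 125514353954016535504 ∷
       253160644643815327713 ∷ 235427828774756203998 ∷ 136512780754679216660 ∷ [])
    ∷  (98045802449170 , 16 , 997846954962231 ∷ 1132731548264816 ∷ 1043256032166381 ∷ [])
    ∷  (78338297166114 , 64 , 93776165657212483685641 ∷ 618283148438731750711 ∷ [])
    ∷  (72680395913733 , 91 , 774521000761984822286446064 ∷ 1406691909263049830515799458 ∷
       643605704565305452458389987 ∷ 844276711141287013191572995 ∷ [])
    ∷ [])
    [] 0ℤ)
  ∷ (14 , 9 ,
    certificate 15
    (  (900000000000008 , 8 , 272 ∷ [])
    ∷ [])
    [] 0ℤ)
  ∷ (14 , 11 ,
    certificate 15
    (  (90909090909089 , 2 , 0 ∷ [])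
    ∷ [])
    [] 0ℤ)
  ∷ (15 , 9 ,
    certificate 16
    (  (2900000000000059 , 50 , 10100 ∷ [])
    ∷  (81 , 81 , 4317381 ∷ 571641 ∷ [])
    ∷  (554320987654402 , 64 , 1057155 ∷ 138511170 ∷ [])
    ∷  (3138678022315860 , 5 , 51238 ∷ 64845 ∷ 41679 ∷ [])
    ∷  (1259705049303780 , 69 , 2880201515609 ∷ 3240823749170 ∷ 7188452696614 ∷ [])
    ∷  (6959095940904036 , 39 , 10088129404082 ∷ 18130912345006 ∷ 11066593871197 ∷ 6290261314892 ∷
       10331097063609 ∷ 10820388942323 ∷ [])
    ∷  (6999666933298941 , 84 , 427158879531821244 ∷ 281544871907170249 ∷ 832031793892443 ∷ 411385938069658386 ∷
       348595643300139525 ∷ [])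
    ∷  (7352219897774538 , 73 , 27138750249856190298 ∷ 8612629601771619734 ∷ 9699859598978143330 ∷
       31941560460403635217 ∷ 27352362071361163770 ∷ 12314830366225953413 ∷ [])
    ∷  (3993346045671051 , 27 , 2054555007884230 ∷ 181584767690224034 ∷ [])
    ∷  (2886780102232161 , 22 , 1273163392608467946 ∷ 17042495490465661 ∷ 256875913374139264 ∷ [])
    ∷  (3979981981001968 , 4460 , 129002801953858807126821368884415648703021391846 ∷
       125898433955207397395389169799236428401722733116 ∷ 124844655435384872009756238017300411335624278734 ∷
       128717999276949780410226369959697913936441389904 ∷ 254061540697013600190271905599878686828595039783 ∷
       126211723601120416623804407759962527016589754947 ∷ 124161137313750399022729237181902910513729490787 ∷
       126496500737408019684894144798846034689986913634 ∷ [])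
    ∷  (5248907029114743 , 737 , 52018921120680066615041060516656257249 ∷
       86907119654744777610466491646179978996352 ∷ 77680475145209534188404736050145646007927 ∷
       63364081120247966921165426580558776169532 ∷ 106100663590729055513946077585984118836067 ∷ [])
    ∷  (6488658014311442 , 1010 , 8984755123368655367127658626910568747412238633 ∷
       10392131827456217262195861135373999116673827415 ∷ 8994022498223512525673401800113118863475965571 ∷
       9425734997130890158883394602179719079541236870 ∷ 10617385420425236606745578298186949717825000284 ∷
       10626676044570706353744097174242215867594037191 ∷ 8111993083224635544161632443475787841099369084 ∷
       9359999847615114477253262052798976664366286331 ∷ 7624049566602995190260220001694303360308583014 ∷
       18958836589413506831283533050580097273377778879 ∷ [])
    ∷  (7186669993330740 , 207 , 1790916830713142546921550213546498142807 ∷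
       1516908706697845508536605094854553823953 ∷ 1193278462046908541021654570311345787430 ∷
       1242716969237094801523267524433240815891 ∷ 2333900315070302579893262788350262262 ∷
       1098874073669077776405623841929470121691 ∷ 901217121488398578411783017124129928595 ∷
       1031425461600838371280727206995387479713 ∷ [])
    ∷  (7943317127766108 , 44 , 14363035963655136316411394484105 ∷ 15407671510166610345789800581929 ∷
       5827236319879658532870400042263 ∷ [])
    ∷ [])
    (533778336000 ∷ 12736070538310 ∷ 8382273282810 ∷ 19641202136020 ∷ 17104667500720 ∷ 17258565961720 ∷
     11639292937210 ∷ 18772949267920 ∷ 5641273246500 ∷ 16767989777620 ∷ 4909585909500 ∷ 18030768129820 ∷
     343889443000 ∷ 59275010571861 ∷ 77945181548880 ∷ [])
    -[1+ 8088038620491510 ])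
  ∷ (15 , 11 ,
    certificate 16
    (  (453719008264504 , 9 , 342 ∷ [])
    ∷  (9999999999999979 , 21 , 903 ∷ [])
    ∷  (6446280991735523 , 3 , 494 ∷ 903 ∷ [])
    ∷  (92547025470904 , 2 , 2461 ∷ [])
    ∷  (9652088020884307 , 14 , 257097471 ∷ 457235694 ∷ [])
    ∷  (3712719008268361 , 17 , 23084864706 ∷ 63423293921 ∷ 23026598771 ∷ [])
    ∷  (3655349995644358 , 17 , 862963713711 ∷ 1966136133395 ∷ 807968762196 ∷ 425412933996 ∷ 1621907933453 ∷
       409059338178 ∷ 32223722511 ∷ [])
    ∷  (8107301978728930 , 77 , 44801512680095300123 ∷ 998644846710165305 ∷ 21828506740729042057 ∷
       19827365944702781071 ∷ 22131519910440973344 ∷ [])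
    ∷  (6502400990579522 , 33 , 991795971866650468 ∷ 125258941628946766 ∷ 1237903292055702673 ∷
       435393257235485414 ∷ 802168424439504566 ∷ 854533067217655671 ∷ 833084210238363010 ∷ 1533860223086352862 ∷
       [])
    ∷  (353490000474704 , 85 , 1614263236306043749903666 ∷ 2126205902656443510439625 ∷ 14707619256138034600120 ∷
       2212594065606475077584886 ∷ 2255220067088271594366931 ∷ 2211839575530515606239599 ∷ [])
    ∷  (7537193070836430 , 85 , 1207719813740942164722747 ∷ 290726614639312405255881165 ∷
       316165583461880624076370841 ∷ [])
    ∷  (8759588021404192 , 16 , 9249868444815702844 ∷ 31010555364805694801 ∷ [])
    ∷  (8262674953373712 , 44 , 391400447728357838464396277 ∷ 1261744833060292556026455330 ∷
       10738251593279597900619835 ∷ 1003409898649620787402731610 ∷ 953500810115671670783276934 ∷ [])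
    ∷  (5018823958107943 , 16 , 58865465522603883065014 ∷ 30137829940772053358067 ∷ 37526363981423778492676 ∷
       [])
    ∷  (7932760994266117 , 24 , 350317298221659041912298950 ∷ 774819131155977699657731429 ∷
       509444668445976344543983122 ∷ 575701129254692467756824368 ∷ 121666849685075385453314330 ∷
       1096846896315348793419711749 ∷ [])
    ∷ [])
    (4010475110400 ∷ 19920020019020 ∷ 757039658100 ∷ 6790181987710 ∷ 9648838847010 ∷ 67562000254771 ∷
     80587342686081 ∷ 12523747216310 ∷ 12969615870310 ∷ 62309141913161 ∷ 29219788022920 ∷ 89900686998991 ∷
     330214010412033 ∷ 203812273208402 ∷ 51751586147250 ∷ [])
    -[1+ 1740996981779067 ])
  ∷ (16 , 9 ,
    certificate 16
    (  (1000000000000000 , 6 , 87 ∷ [])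
    ∷ [])
    [] 0ℤ)
  ∷ (16 , 11 ,
    certificate 17
    (  (9090909090909089 , 2 , 0 ∷ [])
    ∷ [])
    [] 0ℤ)
  ∷ (17 , 9 ,
    certificate 17
    (  (19000000000000004 , 3 , 42 ∷ [])
    ∷  (6654320987654332 , 1 , 18 ∷ [])
    ∷  (17758922968104226 , 5 , 13970 ∷ [])
    ∷  (85752361973675239 , 4 , 3106 ∷ [])
    ∷  (97249514058504726 , 15 , 101095776 ∷ 15178564 ∷ 72495423 ∷ [])
    ∷  (11525598030347474 , 57 , 75113962335053 ∷ 165323872092057 ∷ 132981230226190 ∷ 75174120532335 ∷
       114476391284640 ∷ 142253069789860 ∷ 264704662698945 ∷ [])
    ∷  (87785778022241219 , 37 , 991782875719517 ∷ 941388882229284 ∷ 687968866336051 ∷ 794395238391305 ∷ [])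
    ∷  (20627619998427302 , 82 , 42037453792482757788 ∷ 13976175561588682206 ∷ 52482443505193794681 ∷
       22293582487687595057 ∷ 43126202139403149363 ∷ 49162644252556389227 ∷ 57999271923326310391 ∷ [])
    ∷  (55571082971892438 , 37 , 113598984267386031 ∷ 344793422528221355 ∷ 3865913600636877151 ∷
       5294497854999996527 ∷ 2891707091754848702 ∷ 5576869486084677302 ∷ 1914671780607586051 ∷ [])
    ∷  (8330876042086714 , 83 , 1694722486863469183903692 ∷ 2016700534636766086464922 ∷
       2071421624551262743444651 ∷ 1223315800465286840707747 ∷ 818491168386627801098006 ∷
       1830503146745018241158580 ∷ 1525907028558799384993861 ∷ 8333728099789588102746 ∷
       2369698245865617008591971 ∷ 1745842222671967142883433 ∷ [])
    ∷  (18184713968251809 , 354 , 6087632243898494855116784027346232 ∷ 7134278415598550897795340873286199 ∷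
       1103730003742717389968112311434828 ∷ 5677755030080949834349006260969232 ∷
       8840867374477387214471006623438584 ∷ 6224042616210612169050154623608818 ∷
       7430307621449836537007673451112805 ∷ 4787746308537696147500603780264739 ∷
       1399887144396607921829110012836071 ∷ 8408426167660159842372462854072123 ∷
       9321738103942687090266979832983832 ∷ 7521141513597982386655870735309130 ∷
       8795546991041829183484611257181473 ∷ 7111585267405347207634929361806501 ∷
       6679112777911427521254721245108603 ∷ 6110291576881262809350957064828625 ∷
       7384889906701869171463828405563043 ∷ 16118767981823205270718029868191262 ∷
       7111521435750778536346584410598676 ∷ [])
    ∷  (43052868023074956 , 207 , 4684141387069003778967404626015593 ∷ 3901130429144253769219173308645200 ∷
       4109961041813106195824135587638188 ∷ 8990269212992497199340778550041272 ∷
       5024210582485439850239791123230585 ∷ 4632136739248155541653532571750578 ∷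
       6835153348454114211918821692079 ∷ [])
    ∷  (8239566043405721 , 838 , 1391064529269629212680016509773697156599068672 ∷
       742183537886530195072860603135199415005338559 ∷ 686590543062058097694979964291993556727860410 ∷
       688247504353005359414482704728604138696718556 ∷ 631823798026682976400017489289247933713530462 ∷
       665008010647120554238495574531744048412888733 ∷ [])
    ∷  (54464225036853564 , 47 , 373076778963546046974495033706 ∷ 105002513432465507280391716936 ∷
       461410495261655502640756648204 ∷ 387599485964013594612654180328 ∷ 80265363290043084734566605975 ∷
       314548188652004093570760794112 ∷ [])
    ∷  (21403743965259586 , 280 , 47096746652088230190436141749545516304517400 ∷
       96169324248227151551986974550953332623738054 ∷ 36117786163151176063539403867043607987540854 ∷
       52929231318621706885971811228898816842156158 ∷ [])
    ∷  (93844204949756152 , 18 , 449670329779689697817952058 ∷ 94829645375742097573647475 ∷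
       56491350064933521021794326 ∷ 361622707305154909256228642 ∷ [])
    ∷ [])
    (150412121395200 ∷ 391049195009400 ∷ 111650714621100 ∷ 712210101221700 ∷ 361423642406400 ∷ 656165610000 ∷
     1820302430301820 ∷ 2076903129878020 ∷ 1705821621761710 ∷ 1399306160300410 ∷ 1200765256810210 ∷
     81200410208100 ∷ 3466891818867530 ∷ 220829693011200 ∷ 952632123625900 ∷ 5108508180491150 ∷ [])
    -[1+ 32523712245346159 ])
  ∷ (17 , 11 ,
    certificate 18
    (  (999999999999999982 , 18 , 0 ∷ [])
    ∷  (735537190082644615 , 2 , 81 ∷ [])
    ∷  (945537190082644610 , 4 , 351 ∷ [])
    ∷  (291787990102118069 , 1 , 201 ∷ [])
    ∷  (445634099985634559 , 32 , 30746877656 ∷ 42350599266 ∷ 49294205223 ∷ 331326970 ∷ 65225196796 ∷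
       19411024107 ∷ 41225482091 ∷ 36708234554 ∷ [])
    ∷  (130096909902989702 , 77 , 1046901434023575 ∷ 1088401525686705 ∷ 964312641296933 ∷ 1074890428520227 ∷
       2143573959982669 ∷ 1463179038428527 ∷ 602242755267955 ∷ 1061998060513089 ∷ 1074623757915710 ∷
       1751644345423691 ∷ 1199075131793637 ∷ 1061199802980240 ∷ 979153065354475 ∷ 950710949819576 ∷ [])
    ∷  (143654509945436592 , 29 , 145674786103751 ∷ 51103158660154 ∷ 105395199014058 ∷ 88302828702944 ∷ [])
    ∷  (746626219873733532 , 62 , 3364374221553571015 ∷ 3666162614622116627 ∷ 4197404670803461017 ∷
       3964670303838913379 ∷ 4320856094372023002 ∷ 5975030373711133523 ∷ 2167951677576914126 ∷
       7423696791643491632 ∷ 1578062088014632876 ∷ 4019548599004804878 ∷ 3918689345885320255 ∷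
       4020967116575242253 ∷ [])
    ∷  (98907789121910987 , 69 , 1559570544224207800963 ∷ 1965229098382464854022 ∷ 2347830367117755745171 ∷
       1403645835520330063682 ∷ 1461346295686308712153 ∷ 1851355075122656810582 ∷ [])
    ∷  (883460970299456212 , 41 , 690272415461655729357 ∷ 1280449149306310486146 ∷ 550267648256361788512 ∷
       658877713380093918411 ∷ [])
    ∷  (664248970300475342 , 44 , 129014724527754425569854 ∷ 246029944223230065507586 ∷
       159724868853848524348829 ∷ 32386766356485621977899 ∷ 76162720375240306233351 ∷ 159663217630383239667645 ∷
       [])
    ∷  (417223600046782857 , 12111 , 494234530842537598477231599870337973356738312966055371941 ∷
       494316139879217409443032644868270380693259722651822311067 ∷
       397077886082165974389331281256818428437939762352893841692 ∷
       493051106314874306293888667759184580675649715024666657675 ∷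
       494438569437973630204402116796934371410842549499185280833 ∷ [])
    ∷  (154187780222085493 , 1866 , 56163721919406963251251023765792901454081005154110 ∷
       15104804265781257707410168537393082307697478405 ∷ 50915501483605505694036527983473558395044252882718 ∷
       54387763884943163795469358435405483607020997884955 ∷ 64393241378520862806823767879336463130377800982190 ∷
       51735580544270549058845116000150535206570261635218 ∷ 53677238348506106915538447619252048195219450044095 ∷
       52036333585171897617868886006384838198911471996334 ∷ 51216217899124814123428228937117183784310405359871 ∷
       50833548473440307726885561751132807175035824761088 ∷ [])
    ∷  (645163019797384515 , 834 , 954499505433676661797985189768256917445111496210 ∷
       1071648392921893536564690909155566795851120308015 ∷ 1063828699563635013658504279352778746742163581909 ∷
       1135412985340560196261507544379419678856480588342 ∷ 1072950506441056103259702585543733036998674540681 ∷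
       1594840499977558623915797120085588874435275398095 ∷ 1134107743645717693865845597823434153243369191115 ∷
       1097671168252776990295955054777605477687290569265 ∷ [])
    ∷  (459211829718880442 , 136 , 448118004534472492894387387317919946597 ∷
       343165624195502498356796853184001821094 ∷ 472296084592543681064107378750773507812 ∷
       448092556128474401423703622007773567698 ∷ 465526459715571127246805755290213196863 ∷
       489705801304431736072775729740092505339 ∷ 427081549443903678941393899887074837442 ∷
       165144297593648189298649260274259048361 ∷ [])
    ∷  (33142970296586594 , 42 , 382216354040142785578961278219789 ∷ 5291264673087538990044985713828 ∷
       390240451803179751999007956593364 ∷ 375315383966478767510796087263477 ∷
       337836178478736890272870669232830 ∷ [])
    ∷  (373491159379047138 , 22 , 145493326762172450371288400674 ∷ 4954247133895528849350663303 ∷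
       222677091883279341605827649746 ∷ 198335468437285585902843521566 ∷ 374758497406392060032012755216 ∷ [])
    ∷ [])
    (1491612220618520 ∷ 65218992147100 ∷ 8319598179602281 ∷ 8213016772031181 ∷ 7984930612947981 ∷
     1558974947985620 ∷ 2213265957331220 ∷ 973842223738010 ∷ 276490999458300 ∷ 78120713088000 ∷
     7542888178923581 ∷ 3213535152541230 ∷ 4799755866689751 ∷ 540740393814500 ∷ 1730093429102621 ∷
     35737908590883763 ∷ 16294501820539262 ∷ [])
    -[1+ 196085308693130069 ])
  ∷ (18 , 9 ,
    certificate 18
    (  (100000000000000000 , 6 , 87 ∷ [])
    ∷ [])
    [] 0ℤ)
  ∷ (18 , 11 ,
    certificate 19
    (  (909090909090909091 , 6 , 101 ∷ [])
    ∷ [])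
    [] 0ℤ)
  ∷ (19 , 9 ,
    certificate 19
    (  (900000000000000005 , 4 , 72 ∷ [])
    ∷  (9890109890109890110 , 1 , 21 ∷ [])
    ∷  (9876543209876543291 , 15 , 878819 ∷ 13826 ∷ [])
    ∷  (776543209876543217 , 16 , 20717664 ∷ 4275880 ∷ [])
    ∷  (5913351990098466812 , 5 , 736693 ∷ 1742830 ∷ [])
    ∷  (1780840970299619133 , 61 , 226898878748921 ∷ 63871404245136 ∷ 226786722357454 ∷ 1760016397570 ∷ [])
    ∷  (9223456790123456744 , 40 , 34315189213842 ∷ 994575528218682 ∷ 1841864265207522 ∷ 949669229785797 ∷ [])
    ∷  (9976384909905163185 , 16 , 27423675365824 ∷ 317088834945 ∷ 35985873226183 ∷ 9579224061436 ∷ [])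
    ∷  (7924799970300025738 , 62 , 502912763564331070628 ∷ 466011301165141648007 ∷ 398546980119514617003 ∷
       6463928361440132378 ∷ 420307379287704194754 ∷ [])
    ∷  (3918990870319101820 , 28 , 15557994412732581498 ∷ 12770298506244694931 ∷ 9638288680654643434 ∷
       10356379251550779605 ∷ 8165204927829376849 ∷ 15735150367947801131 ∷ 12476680760739615632 ∷
       12490126301949908508 ∷ [])
    ∷  (3305366819823354962 , 66 , 20537485664602418580224184 ∷ 30066140904762622747447552 ∷
       17854798702272710166294742 ∷ 15089034236104117252359993 ∷ 16303285033606201329613128 ∷
       15530584787001359648378353 ∷ 14374054298539737147699720 ∷ 18636455174825080225055768 ∷
       17620969895152819223344888 ∷ 16879858819597856572520146 ∷ 13713808715662366971994953 ∷
       10238068347214691609071351 ∷ 15300387927613182719015652 ∷ 20557695780031631546302072 ∷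
       13274017256632291472729810 ∷ [])
    ∷  (630633529746638624 , 77 , 17230903293425267831538781882 ∷ 19135138786800624987187129443 ∷
       19117378699277116102979481447 ∷ 16064775495941488097237135339 ∷ 23014294104171990860184752226 ∷
       14158938842936697265763046622 ∷ 10913370762586554489944527673 ∷ 20094264438642136280431721602 ∷ [])
    ∷  (5412128240581687889 , 641 , 16220598932964149330626998396971531711560528 ∷
       16731016568719706882169977214807099065894584 ∷ 22631904749666406157479468064802223976774875 ∷
       15507820788532518225476437273441897505652522 ∷ 16143868108131551971975059730416141728892207 ∷
       14944703380889471534039745251039829127519209 ∷ 17113456590815531610520418141169989741433550 ∷
       16552349335398440201409934001031219156457717 ∷ 31102464817919051779112417252143698360498915 ∷
       15556221354422552697160958537098144952493375 ∷ 16730976687914245161228913830313119226126445 ∷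
       16348019114065348934710646582921958230350898 ∷ 16373821514611120813097615426940124761221177 ∷
       16552190308421573800396403350028525185648657 ∷ 16552150427531513267442262666539427092941400 ∷
       16654226000316596012528646503861383666175748 ∷ 18288510007221115714690561577579162435282836 ∷ [])
    ∷  (7544139359370585533 , 412 , 28046491461847623164382069664573104110852853 ∷
       27033177871072152308557700254155248521034480 ∷ 27098464409947985820179272370558974510142177 ∷
       22899790988217654457243312434501688338792702 ∷ 31700818771681620298996799490642755927186031 ∷
       33935033938176423320821450893163019564215831 ∷ 55799811490085969011491541418292804525237213 ∷
       27575227128099382219805917937398832513309325 ∷ 28315752786300209613651706614310792702160336 ∷
       28182392335786653792371320846199656792592708 ∷ 29199977940811416854725429031036209319939406 ∷
       32305929192544717754038825164358940516902961 ∷ 27640509893460613717938946190965454286774078 ∷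
       25611096135665814843730205555362525458615829 ∷ 28653329598804725215456299554565626844841507 ∷ [])
    ∷  (2971608220770939320 , 2714 , 282877287773454693748838176658839602517115403267336971220372 ∷
       285919407348030802923581365686923864131481905644192882061299 ∷
       357356392548654014540439151156043411385654830604179180568394 ∷
       255024889479456393747364667736378155253508292652201163272447 ∷
       285185282537338135960690506277798025674432269569040703334233 ∷
       286234355380785133912934073368077974863193760730088847998659 ∷
       270604232233731933132525149063920925617478556063680433824874 ∷
       285080241974562381005692703067677592740272963692423072585670 ∷
       293892348896610368363157445550972633134735996254910207360796 ∷
       285290187923541158118719666577996510404702617669750422705045 ∷
       284975916357406744691048706946055141989513281342660775051737 ∷
       285394629415491806611647313723804321302344567118244947568054 ∷ [])
    ∷  (2663518940510846371 , 85 , 37678262249462475836105820920546489880 ∷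
       51037218844641765020238664500831147212 ∷ 42485746873474119122536031917960860216 ∷
       60667432957740998419932615586245889577 ∷ 41957363661811517202289549866393674701 ∷
       337157605335820910103002313307625683 ∷ 45167342031489557103314962542587179167 ∷
       41957380869079704757403170866740731981 ∷ 33528064441272437466591985215875978762 ∷
       48380482509871562296794452888891549291 ∷ [])
    ∷  (8207152540537483898 , 14 , 105979063145906189811044237 ∷ 2911736578031865041989382 ∷
       9245569305790550789700171 ∷ [])
    ∷  (9454823929715814448 , 20 , 2641690094453500993088855670721 ∷ 40324474056224672539794266954 ∷
       1258768737455469124302861456695 ∷ 1326415663146958293629698098351 ∷ [])
    ∷ [])
    [] 0ℤ)
  ∷ (19 , 11 ,
    certificate 20
    (  (900900900900900901 , 2 , 20 ∷ [])
    ∷  (82644628099173553712 , 5 , 55 ∷ [])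
    ∷  (6355371900826446300 , 1 , 69 ∷ [])
    ∷  (27454470999925545181 , 57 , 10757935820 ∷ 13057471681 ∷ 7773965615 ∷ 88918345 ∷ [])
    ∷  (21664952999740533782 , 8 , 3554258 ∷ 23502143 ∷ [])
    ∷  (76462498505204735416 , 41 , 15895904184047 ∷ 167741435616 ∷ 22722119236343 ∷ [])
    ∷  (98954659000043550097 , 90 , 167561951037086738 ∷ 372240692359093323 ∷ 543900349758696741 ∷
       556839522623279266 ∷ 913064588161960461 ∷ 818061809098110339 ∷ 811622320628733504 ∷ 524807675534535027 ∷
       47696243074668003 ∷ 1149613192723221389 ∷ [])
    ∷  (6005540306964390485 , 81 , 18212842960217776361 ∷ 43586963586870943302 ∷ 331734453114327440 ∷
       14657500414713553627 ∷ [])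
    ∷  (48927384198516280143 , 48 , 29989942147887063399 ∷ 25468142034545054922 ∷ 22458082668019699143 ∷
       349172285287258182 ∷ 34011344470750485673 ∷ 1938306272217310938 ∷ [])
    ∷  (92669283900617033716 , 73 , 299223358170165417178040 ∷ 332171792080078029085020 ∷
       152648384637327099564248 ∷ 322588008142870148318856 ∷ 450058641345504404242766 ∷
       370411198757100983754569 ∷ 562985069884315043537907 ∷ 205054821797192278245647 ∷
       473519444475918365132143 ∷ 313421988177562320500290 ∷ 247202208701374088275513 ∷
       638755915423634582416566 ∷ 660931814600193132433093 ∷ 195310337053379589726996 ∷
       398198396002421461408084 ∷ 402527173475845472158950 ∷ 690713844794015291905427 ∷ [])
    ∷  (78187862395831208215 , 85 , 308854534448851000942876066 ∷ 290768996504915152245217012 ∷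
       532594962825285658827800510 ∷ 235763784151043716056958015 ∷ 246902441287498685292752048 ∷
       169921074885451729947484997 ∷ 459674490717600881685841001 ∷ 623453254788045028464364811 ∷
       341946848599353760207829836 ∷ 413093988705258353575533180 ∷ 235657271407137290996429965 ∷
       301714254125188531113478896 ∷ [])
    ∷  (49079794197592119065 , 89 , 130365735893218179090232777308 ∷ 161768472514107562068862556408 ∷
       125003745319121581852095438266 ∷ 135854430532622798517773423328 ∷ 193200923308867674773396638055 ∷
       168206240049436292605276800869 ∷ 188890971319012427137352375200 ∷ 92307251477141479810205074981 ∷
       162826415361659001083448228210 ∷ 143398130826122971959015874840 ∷ [])
    ∷  (56565353296736524352 , 1309 , 387711613615271014578920686179988501633448375190 ∷
       313525840142771366407856724607240571968656551970 ∷ 297427673140951505320091917533333768577573159257 ∷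
       426713735217413353151754438446448780595395869058 ∷ 390711632435202830249363551809499913919349261803 ∷
       380345857774750429539600928950909980839946362570 ∷ 375983556406570667987949360195174870493078423100 ∷
       395895718174051335532860469125409763163071851727 ∷ 714191834761475200692532028749814754941353182186 ∷
       356618452609890490257758178715150421879125911623 ∷ 367801222102993179720092622515882320524033945954 ∷ [])
    ∷  (50764147000248541859 , 3743 , 5675402149489495242858422699609797635893277180613568558477 ∷
       6216202821932502685009400310000529366261498614627699460580 ∷
       6513569432900418441920754695084748622037489380126703165394 ∷
       6878777899449923575450411368870424635026085785358656978323 ∷
       6525750150202379378603772055796823479971215452249769003138 ∷
       8819578075415835322050245242558967571361238332608127455944 ∷
       6917033303158268697839580670446075166407937739709576080672 ∷
       6550098806815274413886519153527229056371486069499051688623 ∷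
       13019311097170312946289924617680577393293108407968261163931 ∷
       6106642814077746553185038763261295156913017895422979753582 ∷
       6810949518218474405510928099860165152372060191206069425876 ∷
       6504879110183733083090294604071591100529196431373042190925 ∷
       6341408851233470077697409549453312272551405881884232902388 ∷
       8697838979004859532306477580610362625506337115379819056383 ∷
       6501410320213056339570852409813125906987601261154542984861 ∷
       7030080218189676233339980254232579526761627752829237101801 ∷ [])
    ∷  (81619446198356083733 , 920 , 8829190696703699963317801682105195455414447304685902 ∷
       9084581698028744420576532730835593524525542334461789 ∷
       6984792277257917910702693783323306606628928487845859 ∷
       9822333855962585397309053647686310118074349328445910 ∷
       10219432848542427569944687315828731907985281614101260 ∷
       6351362383074752625232502092359661495063774900666129 ∷
       7693794833023481595165714605048207703372773096643189 ∷
       10049473655280862010003284267977132149093032256606830 ∷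
       17408207562911865933810976418868841618809737962547834 ∷
       9614511135303642602747827345514111456753925360707725 ∷
       9273708998733218126985411362050506808458331983248441 ∷ [])
    ∷  (90156447495156347919 , 858 , 5800004988751713477118343732123639831348250119452344783 ∷
       5463419663599979954501155220989028349148487876019523122 ∷
       4824318140155759092856329661239979127357990446468781278 ∷
       2017307431871683296725262473541818773655824589485179534 ∷
       5566155941053937600206870537697709013666839821346613576 ∷
       4772961655799915285103690743381006282136105604107651771 ∷
       3472064633677334072248929959664917553829572911036506200 ∷
       4521951583811133251088770507594690609026743752560792897 ∷
       5389189715260373473740311234523976315451517271183987734 ∷
       3022308353414170302414729176958458786380556816187979 ∷
       4036926204332170432780109767506336879148978432718114704 ∷
       2479293211402215144481726808730906192038626823339602318 ∷
       4812919641229111767779703471274369374865901836244197342 ∷ [])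
    ∷  (29508570000034095158 , 216 , 153051125716145493028003287985026436854437715031 ∷
       119337539144692506351461105111915093950432998012 ∷ 132551191702713938612286812075407145700580637555 ∷
       285946608749537981448109663060165219058614908476 ∷ [])
    ∷  (72293992801719606720 , 85 , 1133005291739192889884897589325752386105656 ∷
       1789792393739043877347270486401296504919245 ∷ 1821137444170907468067880193957512324337210 ∷
       116395667369537249399485933539611951834934 ∷ 648145239825879208855025496365428572875541 ∷
       7267153487996157659254586963757726665488 ∷ 1789148885954782542785527711223770940908197 ∷ [])
    ∷ [])
    (50936930287391500 ∷ 996077622157806001 ∷ 1021047060596511201 ∷ 75748541358475810 ∷ 130562079812650310 ∷
     222223100013222220 ∷ 916369948489637191 ∷ 1019389616059939201 ∷ 155044132314394620 ∷ 16935147525287200 ∷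
     1012262314231632101 ∷ 1198080058599808021 ∷ 1116687293927867211 ∷ 59129914190308610 ∷ 243212896993123420 ∷
     1607109717169117161 ∷ 2951070172720700602 ∷ 285340135410424930 ∷ [])
    -[1+ 82821969197248635178 ])
  ∷ (20 , 9 ,
    certificate 20
    (  (10000000000000000000 , 6 , 87 ∷ [])
    ∷ [])
    [] 0ℤ)
  ∷ (20 , 11 ,
    certificate 21
    (  (90909090909090909091 , 6 , 101 ∷ [])
    ∷ [])
    [] 0ℤ)
  ∷ (21 , 9 ,
    certificate 20
    (  (99000000000000000000 , 1 , 3 ∷ [])
    ∷  (90123456790123456784 , 4 , 36 ∷ [])
    ∷  (76534177829712185648 , 6 , 27444 ∷ [])
    ∷  (21402002050497997953 , 18 , 29048108 ∷ 53365695 ∷ 68352358 ∷ 60865148 ∷ [])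
    ∷  (23357541629738542469 , 7 , 7210695 ∷ 11011380 ∷ 10996095 ∷ [])
    ∷  (57041385880204158597 , 26 , 653414682498 ∷ 1095099679886 ∷ 1052058156436 ∷ 964567898961 ∷ 11500086652 ∷
       [])
    ∷  (29476870199989313243 , 63 , 33291990535071185 ∷ 38117176491260996 ∷ 26389943219274195 ∷
       32243086297803334 ∷ 28517250522780111 ∷ 15724531897992560 ∷ 48787413479099434 ∷ 67404957582182259 ∷
       31177728676120123 ∷ 7173241203898985 ∷ 30128167344343632 ∷ 42367959952176690 ∷ [])
    ∷  (48227263909906372777 , 98 , 175759057737557566454 ∷ 57833278621598464506 ∷ 225711086131155030318 ∷
       193918136889674772432 ∷ 289193169880329237902 ∷ 137149003903972466304 ∷ 196050109394161889264 ∷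
       146326506500411735434 ∷ 266360284625469752061 ∷ 91952024489368215983 ∷ 1007563159311575238 ∷
       395752309621980389210 ∷ 257551148066378192385 ∷ 100980473993349149582 ∷ 78319556051772565654 ∷
       266543125764487912131 ∷ 289228650388171659054 ∷ 198489297336912853515 ∷ [])
    ∷  (48515679590050233855 , 76 , 6087810919133473400650 ∷ 6270985897001366446767 ∷ 5076444368183084990363 ∷
       5351818138819337532610 ∷ 4847025874996813397474 ∷ 7007583182468880967643 ∷ 6229238694699281606893 ∷
       6915384338478533607547 ∷ 4709494076708043494155 ∷ 5720574120612531150162 ∷ 5949384183786481582466 ∷
       6316903730334824838623 ∷ [])
    ∷  (90645258309881474523 , 100 , 2750603862400284423699560 ∷ 4792504865692383675392748 ∷
       1777064072063827343538323 ∷ 8128713949555431692333572 ∷ 9847244271470315862578188 ∷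
       11896543654731362060284811 ∷ 12433648490453184873427635 ∷ 19856273157162893612444633 ∷
       6082544722931208274660364 ∷ 1023612167024563481714700 ∷ 17920469148655010669578501 ∷
       4895343425964023219712341 ∷ 54348618830825636346908 ∷ 6512545518128853778980762 ∷
       7265480579543706585633163 ∷ 5758030593221359639085353 ∷ 3498724524039374913723930 ∷
       13401334759306150745542015 ∷ 5005639136760222142051559 ∷ [])
    ∷  (34847270300070272512 , 98 , 563476500341318665068683540 ∷ 1655657866691350628090554696 ∷
       2176744385710300678783045407 ∷ 3234148183301967804890235857 ∷ 1188183242793540882702454876 ∷
       2037823404493257070734209320 ∷ 1586986754639633673477398384 ∷ 1170752485307866223561751485 ∷
       3407669741804528011182838239 ∷ 2610148030017880159971286890 ∷ 1862979102061290519736677677 ∷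
       3337507439466576603137757431 ∷ 3286962472285986668534393229 ∷ [])
    ∷  (99991081839608189105 , 95 , 1289299410257355978572330971 ∷ 218005650330072741398171846585 ∷
       128505405946344014762432916437 ∷ 8262620695918327070998845221 ∷ 307605074087181363321653886756 ∷
       62491057326289417564401604732 ∷ 74152972701945967984830555192 ∷ 64897385313529117310176354484 ∷
       104933577909127268407729561478 ∷ 137884861050035670886656922139 ∷ 194433757681359239731716267451 ∷ [])
    ∷  (63442324980205767548 , 2559 , 4412624477891794851747283253203728581415056485593564 ∷
       4432505208702642897234192927610095971077812224043435 ∷
       8482937017663975954816165671904286460506432876958672 ∷
       4270089350943581131165026564599832271622260274214418 ∷
       4422562576954149343062267952387605579547859399252416 ∷
       4076180181005316317099517978459296859739745504381541 ∷
       4354612731829119456186538105771050200946994463126995 ∷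
       4198805438410082764025142196067976807861398627345903 ∷
       3774569414680340786404476763420975721811742075794272 ∷
       4082808818452738253719818711816333996745248033666686 ∷
       4218707860679365399638530274825911457070830307852809 ∷
       4321465660371571574817354033170951067264292476607979 ∷
       4086123459701965801764069521065733690555008163079735 ∷
       5166674228183984865352644957235263685059500421828540 ∷
       4336381875001420181739563355546576558312677798837713 ∷
       4447424013718777064755796171896869469460282232890777 ∷
       3923706630793255258219621048871727864552885059863232 ∷
       4346325802037883004711822275699486459843997247628745 ∷
       6144538728058786436806920463781450920764393320843719 ∷
       4208766847788227411625469154388643157381149607308839 ∷
       4306552359760579575368163486488997733491522210040279 ∷
       4523656255506228332238885462238730136662057861613956 ∷ [])
    ∷  (89120399819810959786 , 487 , 280971774120268959078930720353481518205290103 ∷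
       273258210245969587035282094433663422486247556 ∷ 337103010939323799878669705028479456239144069 ∷
       292206080879118353205456932750053056162422178 ∷ 353232420166433313526641849549853354129283926 ∷
       353655110590697237533813067027808155981178 ∷ 586139435412062475230412548725851647916834915 ∷
       284482447006036364566789576148168835640676705 ∷ 347621384051889471120651482185624414355284428 ∷
       160307110280164024023379369488602487457129957 ∷ 327277589555942727577008036117657307190199902 ∷
       217832839289161588799956266287890730611396429 ∷ 294297803610387198081088220502247194989517758 ∷
       341998117080919493320694720549028003188920357 ∷ [])
    ∷  (62206580119770143990 , 564 , 6421761333413603192218516341171569252685121115667 ∷
       3558020450145351978111042876794798980780803000791 ∷ 3866613982556595551638900555163938645408076726113 ∷
       3189721469658219233051567388457709362963540548 ∷ 4162831221725909466726855400821775016828455204590 ∷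
       3681499396454896132481469800104951760655169504364 ∷ [])
    ∷  (5321622119777738755 , 207 , 103324606079714480043471004872785742178842618 ∷
       104878316966521750019744442588037182892202364 ∷ 35971013906555535482820802513185376846432897 ∷
       83982694161795663377372239387483035234940473 ∷ 112628107416071675885258719679453719211542106 ∷
       68503504551387533074013256050139633485938003 ∷ 377668131044623554732838062525220948886842 ∷ [])
    ∷  (12808098339660991912 , 609 , 16908499774327125030815960009986146007522364518611186964 ∷
       14108998944355723726336119075674630779462447693909738 ∷
       16010216780678529150924072401618325132199804619052612433 ∷
       19197780845509953636893984395760724945240281386375848940 ∷
       16821400534255330307951677632513368613531835301946406315 ∷ [])
    ∷  (33031311390047868710 , 145 , 113480761021193445795781895095947738480272035 ∷
       15337864520582099708278070719416439988702697938 ∷ 16907514921624765827800417621820923128819181741 ∷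
       36609308638981633225103260012287415983664627614 ∷ 21157989844290215129693119890288985240003097527 ∷
       15109327097109186043141462934106465276404805811 ∷ 34591044641287172881897116402723618277883155467 ∷
       44225339830612468676652612640270884425622586430 ∷ 4594772346651536782054417627927076964763495264 ∷ [])
    ∷ [])
    (227720778116832000 ∷ 1005143889440510100 ∷ 1972099231901170200 ∷ 698590474995797100 ∷ 448783121277855000 ∷
     2350060201961053200 ∷ 1332490666085333100 ∷ 260087474791062000 ∷ 1281509271905183100 ∷
     1485271475072584200 ∷ 328453939443923100 ∷ 3195216817722492300 ∷ 1728661091057917200 ∷
     1316677009687603200 ∷ 4011362748363110400 ∷ 3069009575009970300 ∷ 429258262851935100 ∷
     3212030212030212300 ∷ [])
    -[1+ 11037021902172447399 ])
  ∷ (21 , 11 ,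
    certificate 22
    (  (9173553719008264462803 , 5 , 0 ∷ [])
    ∷  (726446280991735537200 , 1 , 15 ∷ [])
    ∷  (8312497348015620478715 , 4 , 6282 ∷ [])
    ∷  (5337857908019124116641 , 16 , 631060 ∷ [])
    ∷  (4487843470992566221465 , 33 , 51999666877 ∷ 34427912147 ∷ 56089132412 ∷ 697049645 ∷ [])
    ∷  (3298946813959135009761 , 99 , 6304479188100202 ∷ 6617506100581397 ∷ 33234767574525 ∷ [])
    ∷  (9280850929996995091799 , 90 , 378463171460603268 ∷ 429555450322545020 ∷ 607789782468512550 ∷
       60636176950151715 ∷ 512326006737493412 ∷ 894359458191235816 ∷ 359404484851559920 ∷ 486763353256371015 ∷
       493197968907646282 ∷ 295555659861436966 ∷ 385250957368439471 ∷ 3322009327800072 ∷ 142918360595558495 ∷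
       575471194837771167 ∷ 334019200045782103 ∷ [])
    ∷  (5292766002080043270654 , 59 , 1467805651510703375 ∷ 2995253332455308192 ∷ 2312293782583473475 ∷
       2471791719382641730 ∷ 2593452753752525045 ∷ 947047848953205429 ∷ 4768349012532659548 ∷
       3238544187485128924 ∷ 2553891948827572193 ∷ 2111224395499810919 ∷ [])
    ∷  (9102715477032448269916 , 86 , 1311469802367511279489 ∷ 21315096051220386013231 ∷
       14918683883493631182861 ∷ 21167406254561634519406 ∷ 16035563248062743376582 ∷ 13116561978760143726508 ∷
       11719696606274674692335 ∷ 21858242144821407575054 ∷ 18806090993448655616481 ∷ 23936375069696220765004 ∷
       14369861036056477860490 ∷ 4059262112231154552027 ∷ 6596591293383159325462 ∷ 6036549332881476356242 ∷
       17572141529667944132700 ∷ 11016074094515148124837 ∷ 18684202097675163708397 ∷ 10333266136886962083740 ∷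
       8683560169817829225879 ∷ 13253009499130116000305 ∷ 18528470294875092417575 ∷ 21731524969189448998611 ∷
       [])
    ∷  (7908927797030317109009 , 90 , 19495945531108884099345 ∷ 923758133013303603575325 ∷
       395837101227986780592520 ∷ 1151023766866562964753842 ∷ 1603684175768483776908261 ∷
       1829901445540563854422388 ∷ 3114056285774942190115500 ∷ 1415613288208486203332075 ∷
       281589162886801264243241 ∷ 887276318083946629725365 ∷ 2546939444470456077723575 ∷
       2130971648651381651938875 ∷ 2588030234306621780840847 ∷ 1943537731253928933750863 ∷
       1603257965392391376787929 ∷ 2173858140933851776626117 ∷ 1527377606913876749593163 ∷
       4016416644505788690301705 ∷ 583913825053545603003421 ∷ 4924467564351334380715180 ∷
       1943537737618219860952343 ∷ 6128385403411923880551033 ∷ 1868914193052412518453704 ∷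
       1226294802333738336738564 ∷ [])
    ∷  (4248218812968208814757 , 89 , 335554832042273871127955106 ∷ 93829782810250974542164008 ∷
       692335789215674645314557616 ∷ 15213163762454964083102877 ∷ 541079080331440483391405500 ∷
       1024766142724931165752922125 ∷ 686054186936083940135391937 ∷ 457127784438828598753712073 ∷
       662243177154864337674439972 ∷ 534865223433588389981629466 ∷ 426125436007889984743531721 ∷
       988563072652248713693502648 ∷ 504674703849140683717362032 ∷ 982926328644860885290369507 ∷
       359768258547268534901112722 ∷ 415481671183996890650326164 ∷ 390196300748004744971017797 ∷
       3055800319911917858749854 ∷ [])
    ∷  (1319014450985557907685 , 100 , 702347175011825040690162028273 ∷ 789233280896253270442534101872 ∷
       454236821959651897836244883980 ∷ 171357649785952203524247285514 ∷ 710979747828775763502927418656 ∷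
       737157977253396008275400577684 ∷ 363002189273917834923084492768 ∷ 515139956806209222312734171808 ∷
       519747566353577959739471427052 ∷ 824065823057001142104195309281 ∷ 710957898650252250583157497654 ∷
       485067429781374989029087287222 ∷ 2304555000637313787164438731 ∷ 676342137960796629106927927278 ∷
       554385175166397440477230116015 ∷ 749683663677304400152332831627 ∷ 693585327810408575438138856454 ∷
       410270776286472722919784441782 ∷ 480718475645990124666195281645 ∷ 389008199363666145292415672984 ∷
       737027517231750841113214184052 ∷ 697868084281819348843327702639 ∷ 641032646607240242461533876989 ∷
       354564869536437882787223886404 ∷ 545689852319731903164609816444 ∷ 515051582734870267767641956582 ∷
       732722696289588186206926914863 ∷ 428274839587079220824940778588 ∷ [])
    ∷  (5208948941095115109751 , 89 , 5528625543072219922569649894318 ∷ 28964197567750616576873521502069 ∷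
       28798641303628874515089232103246 ∷ 26828248222838571393378751184387 ∷ 33010817050249776032667904013029 ∷
       11136730957146737456323865966594 ∷ 34574388078013857932675828039833 ∷ 12880939391298223652061468584424 ∷
       3030325704326335718315890010882 ∷ 5702752312015091247130735801783 ∷ 17521752579613361240238684172530 ∷
       32245887417752791042171122846433 ∷ 23346268678761687316921996329021 ∷ 26833646450081923881311302470976 ∷
       18309489488317322342217982689918 ∷ 15793793124161357417797529280679 ∷ 1058741381136771764763064457930 ∷
       34233696536570291082820067441987 ∷ 19110325822092718367156647633374 ∷ [])
    ∷  (438523519009457415582 , 99 , 697327082734086037179368248250895 ∷ 14129661233024592892950858186173793 ∷
       3286131242234005892767400196388324 ∷ 15360829765972813273500921774455204 ∷
       12914664664440833303102922867415546 ∷ 8172178575201275257006915250313950 ∷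
       3589321168925644841737123087958138 ∷ 11380394932576422333694133220228380 ∷
       64793637481581530157400989303286 ∷ 23309997386507402649322962097981989 ∷
       22569494405150247463787278205189095 ∷ 10001916591969617519359287101686360 ∷
       77139688065952351791946135503294 ∷ 3880951502181183253579074223491378 ∷
       13210942857338707392503081524772990 ∷ 17797657305976359120531841890649197 ∷
       542276405542665574374045635074107 ∷ 18101568315388638453905638757595206 ∷
       7877469998870340642402500251582315 ∷ [])
    ∷  (7825388907030010547218 , 890 , 5233129658966316905291051120946100779701813569387557 ∷
       912063319199538094667693904019495630707103381838725 ∷
       3639212126915005843777515973019651806636952648323589 ∷
       9715271615911266912834157678836213578909794307545964 ∷
       7028435346686869004845789663948178418608350670479712 ∷
       2902799381980641817139871719382691833713104799381 ∷
       4853375336853333013083909989170813425166307724383771 ∷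
       8541459576659944793366565158918865293215878306649111 ∷
       6648651941137811532520944117536968148735695905482310 ∷
       3944272971241700604262172581346658322353233570661714 ∷
       5307836108501995432617857676941973655796988656467599 ∷
       7943514642758803296616960426155240396189849191010933 ∷
       6303291446588996062176244838072514881558152731085650 ∷
       5140993668021006575116406315491060403057677422691212 ∷
       5492056305037677143387394418020769123599460508574862 ∷
       5238961128666018159189620753767385800706266401048648 ∷
       5998417973044610824354350476559669501501365946300312 ∷
       2425184575002722913278903792072061486901426996913497 ∷
       6153649315749914784370849809076119325925601343835774 ∷
       5302243773130085977621365106684565527803743348453088 ∷
       3754376412445675058818549478077050416081182851045157 ∷
       6729053975580059867970462240979003023081666320251066 ∷
       3386200906716345818309560637257355914747349719942563 ∷
       6470182298389255861828858195789634690774633214112905 ∷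
       4341250061689199432832537980468617689566952861752225 ∷
       4312303194022694767814191657989488980451351620296945 ∷
       2758811069558937173944412064333177212393352922224000 ∷
       5561128407568669172722121481256605184490592377942287 ∷ [])
    ∷  (2499176076931032910487 , 2523 , 459109774266900483426963208895484248766853944986491505135641962 ∷
       410019769666118064897626603128984939663852675598064577782992613 ∷
       516527154178440912920347417444622364849782978345776769559650728 ∷
       540457000558739739513448553195849296377371884808047163840016705 ∷
       512986731771689676993699087701391881635772385796912981561571777 ∷
       377584161094690913714170784340461186107464863364568093076477143 ∷
       108907759717579370480451097330824588501273556900778935018137429 ∷
       461413670875396486414155433060853530040566290980578025267205070 ∷
       449184221346842260359404714086167823332467577217652900149396810 ∷
       636691959015646165228956924553168543734715924795732383700233926 ∷
       608865969642357754789267244128526355017536441802946497642313081 ∷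
       466553570139211645839529184822098081125549886985985386728128176 ∷
       452197803440399012443975292747854772736966670416175009027500983 ∷
       472402101490906895118428184302593768111858268065953339163157659 ∷
       894381228245837205899760992744931249167599442483437397669740227 ∷
       647682216210699372945753529267863841324433271182703994717473228 ∷
       420119952129715929637128582008223023979563183801306136889925974 ∷
       50233981961574749603297509555011200603209710076302577336302141 ∷
       574838923923446390309842186598379749448411382318406778481312670 ∷
       481972495611024724396961716073954240064265331512299020458161670 ∷ [])
    ∷  (6942883529896362075122 , 56229 ,
       4137246691958581525688842506420274981625670627419052591965752507098650332595230220325468917 ∷
       4150937018571807111739878365480411948909281110603269402401497682677223146952789715699974684 ∷
       4037439611709473566050555943784396590165692305789347236481030991339244936153936169564821876 ∷
       4118698396778054755382918712771867850157006764317884702784309743958013595971880319057558566 ∷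
       4112589353139010267861357452323668585072845811895886304773385457904973315682100749068225049 ∷
       4118036034311117203622464923594617740234903037876299470390325059134136939632178937984232763 ∷
       37973570593321866069382048434838991296331203727521240920499321373212908120764344618815 ∷
       4129591829808607569880128797830629291203502268925146044219867910260427651158018447034561832 ∷
       4132756845074891587309717719572236662801356452355701909188223173412035701598460230765044058 ∷
       4136289846543423376460914065262238845819152361991233179628918941604057544741611701365395771 ∷
       4123703561659154333811551187568547877330867378963540630487212807454002802250596277772062030 ∷
       4070855853753210883657310930255380843810124859160174434992110767639679651974574947384083683 ∷
       4150348214336813753240281757489412267989766700915321079392710762546210795598859201932819486 ∷
       4107510666677567798885234563514407350574502065356446767910089501420319519779043827956012083 ∷
       4128487813605523839278179950026268572444523927440149754367827721592249372638126225670663999 ∷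
       4130401508362663352406752273483247741866953836322554479695865599861259949976290938815695747 ∷
       4069310179886802742418238772668019119431820202132338907464045618576661901982732997177467728 ∷
       4131652791565302433705808497461751940528950259224797422646138321275952680892413135457385416 ∷
       4116637561339937978836880295588452576169377062944411534318345065964821744789075277791186213 ∷ [])
    ∷  (3101057373961724989856 , 1100 , 1470202205990548934396026580425314003448696215390642263559499705 ∷
       1196871415785577220898653582234594975447432845593917698872038094 ∷
       1528986353052116358270970132779800155423235106528089498455256553 ∷
       1637723804726527828824977022497008351433754034144108543432086802 ∷
       1528977678921817671887773208456642637713541241556659005760762130 ∷
       1705321434450091438360259041880795162979712665230360774762492068 ∷
       3233585085076636293284092670583046977998604802644117086299182250 ∷
       1733234022822705033178598246882426207999497358015429795108654624 ∷
       1245373938037985359716745085495038923307829360359334979174406161 ∷ [])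
    ∷  (622084974063050877382 , 314 , 60584041075063224494149268355010819769633880430955197732 ∷
       49230285797448311834460290717385629916738204777834972116 ∷
       48328161084428361735959345868235819411692579472974295397 ∷
       68650908444189398188972517963002896711597058989655280286 ∷
       93908246329490476521951097689350704550589670636356345739 ∷
       90012592599762627382996376788239007969302783413833730459 ∷
       54606453499874640797813517707142020540830098314414782710 ∷ [])
    ∷  (3807931064064896019165 , 143 , 2192489970510081902162505329344171834150755803680327 ∷
       1675103867410093013672911164394344732429030681848515 ∷
       2623418506767832816971420005325919467739075922079197 ∷
       2609595254558873121706992405733487084292182427946791 ∷
       2825033079012217989822538332138995322801466450684854 ∷
       1171743482938163939514685166410864987956539257294893 ∷
       1847114387246494212368703551063784057248562077098277 ∷
       2135036252759756266288644577878856665729524183944140 ∷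
       4118573028100302947524170683945783656899054252637778 ∷
       2048529123183294303631351515237459727807627930763048 ∷ [])
    ∷ [])
    (20780897615799078120 ∷ 3991233283332090400 ∷ 121913477393774419221 ∷ 15073232899332271510 ∷
     99674291929193367001 ∷ 111118190576091821111 ∷ 69279375605583882871 ∷ 79883181889182278981 ∷
     5793772727168388600 ∷ 4678401202103787400 ∷ 10223000576100322010 ∷ 23411052495350114320 ∷
     15768690060986868610 ∷ 77626489969984725781 ∷ 98909787645788008901 ∷ 2854908221808459300 ∷
     4956389898993668410 ∷ 29407220586021704030 ∷ 77778121909220876880 ∷ 266213168716871212672 ∷ [])
    -[1+ 6404233322089355641339 ])
  ∷ (22 , 11 ,
    certificate 23
    (  (9090909090909090909091 , 6 , 101 ∷ [])
    ∷ [])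
    [] 0ℤ)
  ∷ (23 , 11 ,
    certificate 24
    (  (8264462809917355371895 , 4 , 0 ∷ [])
    ∷  (57 , 57 , 1514205 ∷ [])
    ∷  (909999999999999999999889 , 2 , 306 ∷ [])
    ∷  (81735537190082644628101 , 58 , 10965429892 ∷ 10967058533 ∷ 95309721 ∷ [])
    ∷  (35137049990099492584615 , 8 , 5324238 ∷ [])
    ∷  (33397861390058412056676 , 28 , 977438190511 ∷ 945558687818 ∷ 1595095325245 ∷ [])
    ∷  (775481103009896989154216 , 29 , 65907107846740 ∷ 41447160872315 ∷ 57963475828245 ∷ 45781249799558 ∷
       51189555266261 ∷ [])
    ∷  (667294027430652696072327 , 66 , 5631122296047868483 ∷ 6217860323094301592 ∷ 5237280601459420528 ∷
       5532457318640216442 ∷ 5340390228163422558 ∷ 7784386212397512754 ∷ 3817999655549256129 ∷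
       6021271922319781372 ∷ [])
    ∷  (333405914809924813956758 , 99 , 10067263002331261379204 ∷ 45268471120179361170307 ∷
       33033072529920845184555 ∷ 45256051407493976878113 ∷ 249146659912981358334 ∷ 21326500132440562949359 ∷
       51129147894708310911893 ∷ 42334412743901608287696 ∷ 45266011682318833248109 ∷ 41348265424943060172894 ∷
       38468079897420595878232 ∷ 42334412806010161484501 ∷ 45283264254704180925506 ∷ 45280730357445567107475 ∷
       35989362594984840051475 ∷ 8092312241178181779839 ∷ [])
    ∷  (901374815440554815258980 , 76 , 579641866177132179138717 ∷ 404278705722936469429283 ∷
       580150544501751497108147 ∷ 319834187395473089030512 ∷ 1034471919806944730686629 ∷
       615022437957035310862530 ∷ 4109235319130531873404 ∷ 537743910200993002711665 ∷ 298743792561492087048717 ∷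
       531769790202647303832403 ∷ 355073062750002098307147 ∷ 621817283951766519230304 ∷
       270857652716596652347048 ∷ 551574054888613089538620 ∷ 664406168853712188180701 ∷ [])
    ∷  (696763691629738136332966 , 91 , 643732988052287644902016176 ∷ 67167750560091306312467971 ∷
       803582559355272726370608130 ∷ 737328728604971208339037581 ∷ 774648284269474482132196304 ∷
       705399632543236838726538022 ∷ 504858212560607633632876358 ∷ 736231934087269310464866737 ∷
       335859178970558408245064244 ∷ 689986111174642176560962396 ∷ 682610847226473251148028990 ∷
       1274933959226838642887549171 ∷ 528315911623963898917429314 ∷ 582277648762618299957972057 ∷
       528150412666735638307617289 ∷ 458605534613460790854423672 ∷ 744280931716187016804436900 ∷
       798194584846168749848569449 ∷ 943897981815276201367377825 ∷ 535940931540808165653132942 ∷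
       635097496067835697672500919 ∷ 435900745828233142850469528 ∷ 374150787676772798968424600 ∷
       567406903626140005517900670 ∷ 620608144620835607396314792 ∷ [])
    ∷  (209171778119792218280887 , 100 , 484808032200521927102469936263 ∷ 828740698584437719189085243086 ∷
       428295951320311931559279593470 ∷ 602350801663689839586814669609 ∷ 223545858000807432908833255438 ∷
       471805186729747185028521424416 ∷ 480458536098158859027508065229 ∷ 476262311524968956782644946820 ∷
       510899392837521222222233989395 ∷ 606572105072587214810439732904 ∷ 493916360526722930557434947467 ∷
       497702051565027034649782023633 ∷ 498071358032412265746145428082 ∷ 611112216194507688417472493820 ∷
       406702936069166036233864191615 ∷ 871902064823642817460672942453 ∷ 719476733641356344000247086942 ∷
       228453360079590817976404457413 ∷ 611201122028980024581163908250 ∷ 463020413398783598802480405585 ∷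
       671452942116852927964428201023 ∷ 711044220062215349474713509581 ∷ 484786610345315876387574000237 ∷
       463107921562098008910979339416 ∷ [])
    ∷  (575005430800019654995239 , 98 , 38684470420638500927230999380475 ∷ 8983806616841257328862858918490 ∷
       28011753707853394542993363532369 ∷ 38708508054646976548183873690827 ∷ 42080765672196406504630392388907 ∷
       17819319742267445445421816983076 ∷ 44670430773631664604556900760195 ∷ 34680209723216502388128689558246 ∷
       40891806410591493711786393009765 ∷ 27904927177590522767864633466977 ∷ 47437933450376409278182584925409 ∷
       48783988134552227803209492426150 ∷ 72987214707440845387770442378365 ∷ 55572816226585771162299596255834 ∷
       862520629603370440027134391161 ∷ 102646863415536819389135600892808 ∷ 35349864562960702867317263436111 ∷
       39996325952343154566449845695245 ∷ 5072207567607406969746270353235 ∷ 45422101644769468064994885772517 ∷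
       75611531817070165348047260824690 ∷ 87135217943347564027444015494031 ∷ 75956933987423446401880760305439 ∷
       288599818019334078278613794240 ∷ 38028517473709954875309883151361 ∷ 32643948631895447913739007505309 ∷
       13750108434237361467303149638698 ∷ 51486695495117411453244233151378 ∷ 39371726472537484616239156790185 ∷
       45428760720081189845836290649481 ∷ 43385701280301122172333515481017 ∷ 60229613173464391561456789026412 ∷
       17146177781248855573399818408291 ∷ 58921584404327206195765500227248 ∷ 21867839243589868300381954896079 ∷
       61558776223830995895623457920015 ∷ 33279487871516358492508411650746 ∷ [])
    ∷  (204828951290068500714955 , 80 , 4077161008708035475865110300900 ∷ 663791926067901446011942287037897 ∷
       403067844909438729642901400965551 ∷ 294941927438216326314097524681703 ∷
       148389374673965679124793107485765 ∷ 844780552224750298390581259848467 ∷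
       600846434119719395703741975300661 ∷ 499075570420696833097705320186071 ∷
       428995282351047491763195356139592 ∷ 687870297632148710039517416704678 ∷
       106138336369125787231006588770803 ∷ 145363327520133759474437030286535 ∷
       947091700533109229508572812166410 ∷ 105607262007277312750087939164885 ∷
       703794933425949134952534564535698 ∷ 515045096677069101477841184565594 ∷
       546689635996663357203151998815032 ∷ 467528683535471670665599189343824 ∷
       899916821978732089437277809433006 ∷ 1213589300285242338556334276614566 ∷
       349932596616530769706443405299664 ∷ 986492913544495211394325290781409 ∷
       161676507708101379521061517924315 ∷ 1073773915537955957830639333917820 ∷ [])
    ∷  (76953212509847876503183 , 82 , 59260663555407415512043528192015639 ∷
       63063091724323290697365106986344355 ∷ 129046753455453887888784294182659305 ∷
       37499557997500009144829164899988624 ∷ 15426110821739173369084218805919664 ∷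
       96054859239519879742198101544334722 ∷ 75911376858027489457574809443491118 ∷
       781768037102345065802393369533778 ∷ 132527958112539947848741287570362962 ∷
       134311666982049251268086443746669983 ∷ 8176409512815450891876179873177510 ∷
       282476505599350009295795777902185741 ∷ 130709787095615176208967445646121458 ∷
       55802227060786679405385721324787282 ∷ 70168629616326899844035274563967207 ∷
       44759760534689366459649822606188571 ∷ 48484861869786754815991517238493970 ∷
       46701140357450179404475005054182719 ∷ 255372085935396033278003725144610239 ∷
       39339633489733804168153582682208108 ∷ [])
    ∷  (797009752580237420902945 , 99 , 662161425158606169495931783148703401238 ∷
       1037658654772857844841957958149512974263 ∷ 1097745713846072818091676669778813499815 ∷
       534687166143642942231495514914039720803 ∷ 1182422844741759550731397499153543755550 ∷
       868117536639775217415731342757359724482 ∷ 371712353240623626554921392276017443567 ∷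
       1199901735210249083287269008869009828567 ∷ 81684972397319392193965779267052528093 ∷
       734652193674248037620952207968533610042 ∷ 904587533447054646353513903309727181415 ∷
       849758146492509313168690093773518597622 ∷ 860155235767556741361718718372431570741 ∷
       26641004444944372291450144049629677283 ∷ 497238445463379295640462612280113240316 ∷
       257671420958371818588028590203563166741 ∷ 673317618967727006614760827851328872377 ∷
       547482066186865066213049236671237509742 ∷ 1025230906557604947631071457813205556318 ∷
       280954291617112526914769642314068334871 ∷ 668118000634526943390167520399555352019 ∷
       971120341867690932641639828799441584269 ∷ [])
    ∷  (155277401099988963174488 , 1506 , 228153615308815377742357495553724851275197921389358217297946081 ∷
       374648489155751756713420747610095577215462895965379304011623652 ∷
       255674249208150482091314010654063289507345503427379846629632779 ∷
       250390163492246717083477010929168441451457603891310478013053779 ∷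
       235658181323320811615307721452279712349831235212853035171397002 ∷
       208139807440517206841123175123692483894491690526510341110667805 ∷
       226623981557921354472241344643808222333534732257831784547810552 ∷
       418693726331591629874537943993598015395246553479958360413964876 ∷
       212725111802015782508623732618160076486487260815508759978296048 ∷
       233295988324568591390225792660191608551319499263300193394493827 ∷
       204524485492283618511975963356056534379958523067824825313577630 ∷
       200355138340249338034027465254936486434825939249271153179077254 ∷
       208416128348463886096950891293989178021600970775809042852974407 ∷
       289311390230886462504640623446042180930188888582075253132243696 ∷
       286245937028612067341247263417576959789839183355494132285444487 ∷
       227323315618323752992299871911072367855074678206307034611997888 ∷
       209389523484016506275085359786032294403188196330946139110415509 ∷
       242746653436637450606106223546922325068413337111767865827675424 ∷
       207861042469621289021669541546602621864678162967713757672702061 ∷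
       214532081158685261559942722958710065775928510858454609751889162 ∷
       205636917664195241275271157236955500560122571385949806024851275 ∷
       212308463128228662493253353983653318574322170087535777026520308 ∷
       213280474294139153383575835819765894888437808275224464985415329 ∷ [])
    ∷  (769451386719833168460333 , 1171 , 5358854472495605289481494127813547361587979125382324848047220359 ∷
       5204865642771169840092550225512061366041059037217597678382686930 ∷
       4964969584065322200023921890762502600434382001273085570823161057 ∷
       5309031609567467480394138153838164050137172210330858445019512976 ∷
       2024349965692471184821688647271109328331855765054992275595218 ∷
       3004320863151308610682228824836494284271911433012931281134985739 ∷
       5087137159179423202507310558387350091894738995585205662086349375 ∷
       3810132853918933314873196318569360953317125411475396764015133364 ∷
       3977798185806200292501298729356881940780065218516492418702790624 ∷
       4471334624093006446839719393964412174136879551948205445054260226 ∷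
       5476565594556547841326103601341598872666240252779266566285162175 ∷
       5186755812127356975520263357637084652958452133727601544428608920 ∷
       5336208943046530893024074578935457654518878779373581972904563616 ∷
       5390503704500068098555821561141129513086671479065175413258242804 ∷ [])
    ∷  (919991355239584468099811 , 4225 ,
       1777024329823736390536080926163054116522728720851284452417305128531679757172896 ∷
       198865063886746249185353323505772070504256817170099568689772630886288084075 ∷
       1697763362048474248090847097053132479776935497484508128817706176194231217402131 ∷
       1483674465912126270885986579713799272990109655332035728494142638289807427774116 ∷
       1773754172192609726612453709754385095115639412468663766995456443180170098465000 ∷
       1776204602889338118823835678130371132726018788718064030274068183419804810205097 ∷
       1705525484433085714596775599736436076885091803937965891694335913361677859497132 ∷
       733155277143909022007625461489786505179670833518913435731195428564740730115944 ∷
       1913070681167586849516958551257081793918026229823847859703520239076366285148304 ∷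
       1877938737206998856441033147899646821800608403683119681317202992111233777794242 ∷ [])
    ∷  (830309577269282239869631 , 412 , 8609332426415909099876498636190950302175652666769905524579790 ∷
       5685960585048919764212741228585780505987051683635844558613392 ∷
       9419157570282619636100318875023006262282013479296238757599125 ∷
       4980686079053677136667364534742099031300878403473887536203492 ∷
       10379072881577474413900125200793755906353540838644068262465582 ∷
       10511473409817114438882961893363103425647269183299796739032 ∷
       10187141664366553562095648035105008805959304123649764694589925 ∷
       8992548680295936813362719763916605467793297211588112827157654 ∷ [])
    ∷  (533164336149483665376718 , 94 , 63636358051772672265558411813293565520680538058633 ∷
       218653595005203811107786975512375108822221518022 ∷ 23286781861449669695585888704863207403078703735423 ∷
       82155508014892135604848559386933789746279990994239 ∷ 82788211410592163173364039557763679657109130135631 ∷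
       [])
    ∷  (72373838500051616257286 , 28 , 16827385769619853038444245216754381346444 ∷
       24059568985586499106541315584970403139597 ∷ 6600654621410797448786066758234970398507 ∷
       7467536748197316550531995669056184254503 ∷ 15138959011018089179336928703021123454012 ∷
       17709591330370926120650011338448120194861 ∷ 18613952333752769023129178194286696534253 ∷
       20593495284141167706864965811112386608207 ∷ 10873753666006220371104052876051428163454 ∷ [])
    ∷ [])
    (550096886768870105500 ∷ 309769913430896801300 ∷ 1632963426033610000 ∷ 716581999190017572700 ∷
     279519567576602488300 ∷ 144652015451014754100 ∷ 254745316162353646300 ∷ 1177891034243008878210 ∷
     69433046155133387100 ∷ 2437790752214808784420 ∷ 670018379597391996710 ∷ 2889715983027951798930 ∷
     1734749651614694852720 ∷ 566665570807645666610 ∷ 666593595658639557700 ∷ 1180613809190840608210 ∷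
     733894532633439843710 ∷ 2245090240614199154220 ∷ 6698568582528576589770 ∷ 2530268274038276313520 ∷
     10939230130913103184011 ∷ 7411127547984573200480 ∷ [])
    -[1+ 553776428994357497156536 ])
  ∷ (24 , 11 ,
    certificate 25
    (  (909090909090909090909091 , 6 , 101 ∷ [])
    ∷ [])
    [] 0ℤ)
  ∷ (25 , 11 ,
    certificate 25
    (  (9008264462809917355371901 , 1 , 3 ∷ [])
    ∷  (9909909909909909909909910 , 2 , 110 ∷ [])
    ∷  (1900000000000000000000007 , 7 , 49185 ∷ [])
    ∷  (8675967565819814342304239 , 36 , 1263327416 ∷ 2058473348 ∷ [])
    ∷  (8617699802729726920031846 , 28 , 23777021782 ∷ 9283782204 ∷ 27978329673 ∷ 34006527579 ∷ 12333949560 ∷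
       [])
    ∷  (9008264462809917355372010 , 52 , 83743214723385 ∷ 64959237183751 ∷ 114603829074420 ∷ 106511597395351 ∷
       694484081970 ∷ 117245241076426 ∷ [])
    ∷  (338586772440557323141559 , 96 , 792990521184532493 ∷ 1152029400961930103 ∷ 1231880531426984963 ∷
       942506780406969501 ∷ 733142946746518538 ∷ 4511259726831920 ∷ 982510935723972961 ∷ 693140126157250055 ∷
       952430641238827303 ∷ 1820595806942375030 ∷ [])
    ∷  (1410986939000000603098848 , 43 , 208414416414473917 ∷ 145940165560340272 ∷ 231427397339245300 ∷
       1447645555249632 ∷ 215097004933824238 ∷ 162425761198309844 ∷ 145862536216832419 ∷ 31181409561342272 ∷ [])
    ∷  (9131480760039590419148674 , 99 , 40863731879755543588324 ∷ 252160377989890076003 ∷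
       62398012426138560347882 ∷ 49186241785307025016108 ∷ 67813973780669644643851 ∷ 81994392058794982704434 ∷
       11476521672369847476782 ∷ 15419194798536185428774 ∷ 15787892442309505998321 ∷ [])
    ∷  (6637821037600041598821657 , 82 , 306796771133328446476280 ∷ 2265866278336654585860182 ∷
       1069590020724814907987301 ∷ 246606350884855283849675 ∷ 1054456231642540143425580 ∷
       904888530871981800130802 ∷ 860381714305337978926595 ∷ 1204384374687184964929758 ∷
       2236044928525346678962367 ∷ 666034199468503689204978 ∷ 2460213833270755724389427 ∷
       1308629998570389428071381 ∷ 97312200645576331866173 ∷ 261473618492658640504758 ∷
       366534553107108618787007 ∷ [])
    ∷  (8762409048159382490957417 , 77 , 10569418372097179680475559 ∷ 684824371412247049509859 ∷
       80029766653658449362829626 ∷ 53992160018339047919441300 ∷ 173142577129063982144387601 ∷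
       53944138594641037716520217 ∷ 3125169851082089000515096 ∷ 111029864171928502834292292 ∷
       145832044621718943777120025 ∷ 50230400474404400168794611 ∷ 88722309179635175744626148 ∷
       84992359466601457030839222 ∷ 16780611342827687736876434 ∷ 47821143541686411613677613 ∷ [])
    ∷  (6340557322719827762439655 , 98 , 104258115450091622029223332878 ∷ 623425834243993565215801003673 ∷
       411665984040728225902776927962 ∷ 145171096960867088363438431756 ∷ 319487741498203606034085216647 ∷
       568794132902196961495953879696 ∷ 131539100149612569847314537548 ∷ 340072583046462724006550843819 ∷
       380899553938599854584532742170 ∷ 545139463949979495885762262571 ∷ 59773502654964180534853530270 ∷
       671380138411483532945861101064 ∷ 298952984584608662326704166207 ∷ 87018919322913114161065828125 ∷ [])
    ∷  (9175453745299974526454169 , 94 , 3719692329311055561968271764059 ∷ 42587760826259202531898310425946 ∷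
       47700363515045461959113081009735 ∷ 2942794276052895774388570449746 ∷ 32786024881265044889868365872458 ∷
       74003771725170767903243682087787 ∷ 5313268943388582371995793325448 ∷ 20618178246777927382615907971060 ∷
       67310145033827144171566735850944 ∷ 66551779854326872029751120680186 ∷ 23732134869925961977835479764897 ∷
       4118705031694609114861602106153 ∷ 59909914217099331857068561828593 ∷ 4922709785596948744827745083338 ∷
       72061306402099366352059663497960 ∷ 45344519424697949084380280602946 ∷ 64202157045997452983672844456048 ∷
       601459150710228619833019249701 ∷ 59494370525030849850920803489423 ∷ 38671722892236425014668648366350 ∷
       9999950731835268211838289295154 ∷ 25317456955105152943865800194591 ∷ 47307792341800495741948146866408 ∷
       14745419090790026058413441486167 ∷ [])
    ∷  (8304841375600035258515957 , 93 , 1116574461603128377852328685528683 ∷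
       5086066296986952113894539125349965 ∷ 30268306432859734724444667148835 ∷
       5342536121740184888924687314521334 ∷ 10899612988678572732952147588970747 ∷
       32330953557961147160156326882890 ∷ 4318092160072757864856359774255015 ∷
       7189324799223988468330006714011686 ∷ 11532779637427710400776056665975436 ∷
       351334232142652415297123448253323 ∷ 6682241931351208959582358024743741 ∷
       10260880540289555048139133499200409 ∷ 925081058247935870983516532137516 ∷
       3422593811726048487863050444803571 ∷ 5273132779230198677159145175358848 ∷
       8409317513726527199278328658108322 ∷ 8280419802835423395861887930676618 ∷
       10644887658833916987099595490256620 ∷ 5466666847029285952087742072427166 ∷
       5211894073965829297789021252242463 ∷ [])
    ∷  (6130121273049587268789777 , 97 , 235464200588030693225679718820831103 ∷
       4360327387893860529371074787196573800 ∷ 3575609048175810327732552678588508204 ∷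
       2098813897054841963291535477529048391 ∷ 1222136540389401559107731142469568672 ∷
       2767438665593646345758034600931854272 ∷ 1874783691535656768492078620988313159 ∷
       3194453892551804951205866081825320882 ∷ 1600076227192317930411864113608260378 ∷
       2006165243374928685959271498692069089 ∷ 3395493108162359686610741449976591597 ∷
       2767204056949438506145156677449170654 ∷ 1893975033490116745770473815381040465 ∷
       1109483630430932826774266053412937903 ∷ 2611808078133784731852305420549945267 ∷ [])
    ∷  (3786160518840520849384093 , 99 , 940545080656580372959715462833440463854 ∷
       517238844386442569839147210086663607991 ∷ 281286641102097049915062972837831617543 ∷
       661732688908059722497369757520444273418 ∷ 366179155780477186437279625713725046792 ∷
       583652074611355665005879580044861348998 ∷ 480734959230276310214731576783348680570 ∷
       432468518183515408461858331450518394571 ∷ 384384889801307072257985090950884931378 ∷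
       1200566121823417965452002669977614405663 ∷ 365783119051149493231021305693533719124 ∷ [])
    ∷  (8208180888720731119181878 , 665 , 82062172722729991032085883777485650105114931613521418319 ∷
       76637648275842884417175435377804880624303381492814055616 ∷
       71998578412724152985138458459911632051560429716435461316 ∷
       75605870650280850985201037511260419234132082909489129341 ∷
       78187983598669873206777138873077743423201729107613531593 ∷
       51204432306779132324510289756385620335684903646494289 ∷
       79737058790597010542869937688193563933953838886761046844 ∷
       71468470928563945129915504938865611776546818350730852997 ∷
       85419939184134108581394670643186031339938261991865665581 ∷
       85161971087747764847557609040314981946474072006614739313 ∷
       447690616796224842850794635321952586571865849876732939 ∷
       91620213868886828694529492286146180128937137418665200978 ∷
       83611052787707948145940975370766149311882395332208725028 ∷
       975186809621405542344697240653581376763156667562165794 ∷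
       83998636927582993750945733626458624367866212219121255599 ∷
       59982507684363130300448956918486033254966452589425088272 ∷
       85806067920597922202120113173508643169506694749389652041 ∷
       77542721757985915415548265621266730704936571355081561663 ∷ [])
    ∷  (6418435618080191844661775 , 1285 , 31955362037444797390493446780626496965389890810395502586076233770 ∷
       31473636525023812242565367548287504574377811897658687626490943268 ∷
       33088333909529820154045528188381702863221509302275902213180847461 ∷
       31690362324861028420515001613165859920692387069331761049329970124 ∷
       40026028727540429581231509101631706421769450539732233427809989894 ∷
       9151641894538438990933771214938202600318917386065242186673952 ∷
       31232782874504576480805416547667999007118115973416773296556759312 ∷
       30509894482756214185849331575216285645052685027260725545003959450 ∷
       30003975778063114887753601022714506523796790438725212737618682840 ∷
       40747530376673439242018874396898692851552418292109420961676353550 ∷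
       30799246646829862680021763713340063367474275119768645058346616489 ∷
       30558205780400876252365253776296478563468877188831430971190560040 ∷
       30100082798807118191062108457946491447366293372505362309997911453 ∷
       31521666550541001731010238697806867172194024891602468523689722756 ∷
       36147158882928721342219322276010334134045849947541195590677134977 ∷
       31473402186218093283064963995025398998189978486498524773791603539 ∷ [])
    ∷  (2053174874139586305176448 , 577 , 8955979460070416690953613030944808097934763282243497288416831 ∷
       12757650088353973715864202806932355011535923410050425689978368 ∷
       17842037798299675125000830248049063983439849175424166892606616 ∷
       3608995798583945031199979962529395878250121563252169730756405 ∷
       8090388179363471546314826257618221202263524741386252392884810 ∷
       9790607849676415029155574188493789936254783122835364440521613 ∷
       8569614474866657731980569143858452110318319413737246830442518 ∷
       9234188884712850511231282026346820452194224467536611643908478 ∷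
       10269660417331961517042487541128796374201090551132721510577223 ∷ [])
    ∷  (5690201181620738188980043 , 833 , 25607142549336222909531561405590795038864799939514262030730872385000 ∷
       23987058503744104589083125699402726487988818949022250748084940210474 ∷
       21927421754905832685610874678953415559907635075134537884280616506365 ∷
       16134888238941952694517773010402881492206485505602220684282633574 ∷
       23162956655713928445542831836232334784751273087684229529011257558363 ∷ [])
    ∷  (84596850200079513045203 , 41 , 307294063501685273123220468626777462800141 ∷
       1030972096538163584036805555770837960729596 ∷ 1646613656098250035429777966917589769115212 ∷
       651577223094929609837953723229582159755652 ∷ [])
    ∷  (3473304382430657165967258 , 39 , 33289847403422762054107547145231549979506819 ∷
       32696651856269933375544191017803045067998148 ∷ 6440738408292261122793907968365696516332610 ∷
       34905218149186386549329078591837071464569094 ∷ 35542083970399035999216341177487812649682638 ∷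
       31575680993625029454619649323588954803769939 ∷ 29933320347884197147190089743383737324582964 ∷
       19848164351070897953693825652029581483663841 ∷ 216007535501080231354898469437723306618288 ∷ [])
    ∷ [])
    (8713034122214293268100 ∷ 15950387175816939506100 ∷ 6104726504146265116000 ∷ 5733376793876734475000 ∷
     26972571607961652797300 ∷ 8016917322327197108000 ∷ 74273832942393283624810 ∷ 81457801773880977551810 ∷
     7674156587857614658100 ∷ 119570439987900439660210 ∷ 20588329606060327960200 ∷ 14650336348526429475100 ∷
     255062830283605520000 ∷ 10318505572755058130100 ∷ 19760306267736029580200 ∷ 20845640383939474391200 ∷
     35761753083812481575410 ∷ 12929970032300690293100 ∷ 19708121852581208070200 ∷ 46690438300028439866510 ∷
     24365244004003336634200 ∷ 59718006112116008179600 ∷ [])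
    -[1+ 5648058182089396873625659 ])
  ∷ []

-- Conclusions from the table

numbers : List ℕ
numbers = List.map member entries

complete-entries : ∀ {d N} → IsDoublePalindrome d N → Any (Lists d N) entries
-- `refl` evaluates all searches. Any number of tightening rounds would be sound, but the
-- certificates depend on the digits that the box fixes.
complete-entries = complete entries certificates 5 refl

sound-entries : ∀ {e} → e ∈ entries → IsDoublePalindrome (dimension e) (member e)
sound-entries = sound entries refl

-- The hypothesis mentions only the Boolean, so a large decision is evaluated without computing the
-- proof that it carries.
decided : ∀ {P : Set} (P? : Dec P) → does P? ≡ true → P
decided (yes p) _ = p

theorem1 : (Σ[ Ns ∈ List ℕ ]
    (Unique Ns × length Ns ≡ 203 ×
    (∀ N → N ∈ Ns ⇔ (∃[ d ] IsDoublePalindrome d N))))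
    × ((∃[ d ] IsDoublePalindrome d 22) ×
    (∀ N → (∃[ d ] IsDoublePalindrome d N) → 22 ≤ N))
    × ((∃[ d ] IsDoublePalindrome d 9986831781362631871386899) ×
    (∀ N → (∃[ d ] IsDoublePalindrome d N) → N ≤ 9986831781362631871386899))
    × (∀ d → (∃[ N ] IsDoublePalindrome d N) ⇔
    (d ∈ 2 ∷ 3 ∷ 4 ∷ 5 ∷ 6 ∷ 7 ∷ 9 ∷ 11 ∷ 13 ∷ 15 ∷ 17 ∷ 19 ∷ 21 ∷ 23 ∷ 25 ∷ []))
theorem1 =
  (numbers , decided (allPairs? (λ m n → ¬? (m ℕ.≟ n)) numbers) refl , refl , λ N → mk⇔ to from) ,
  (to (decided (22 ∈? numbers) refl) , λ N (d , p) → bounded (22 ℕ.≤?_) refl p) ,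
  (to (decided (9986831781362631871386899 ∈? numbers) refl) ,
    λ N (d , p) → bounded (ℕ._≤? 9986831781362631871386899) refl p) ,
  λ d → mk⇔ dimension-to dimension-from
  where
  to : ∀ {N} → N ∈ numbers → ∃[ d ] IsDoublePalindrome d N
  to N∈ with ∈-map⁻ member N∈
  ... | e , e∈ , refl = dimension e , sound-entries e∈

  from : ∀ {N} → ∃[ d ] IsDoublePalindrome d N → N ∈ numbers
  from (d , p) with find (complete-entries p)
  ... | e , e∈ , _ , refl = ∈-map⁺ member e∈

  -- Completeness places every `N` in the table, so the extremal claims reduce to a finite check.
  bounded : ∀ {P : ℕ → Set} (P? : ∀ n → Dec (P n)) → does (All.all? P? numbers) ≡ true →
            ∀ {d N} → IsDoublePalindrome d N → P N
  bounded P? all {d} p = All.lookup (decided (All.all? P? numbers) all) (from (d , p))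

  dimensions : List ℕ
  dimensions = 2 ∷ 3 ∷ 4 ∷ 5 ∷ 6 ∷ 7 ∷ 9 ∷ 11 ∷ 13 ∷ 15 ∷ 17 ∷ 19 ∷ 21 ∷ 23 ∷ 25 ∷ []

  dimension-to : ∀ {d} → ∃[ N ] IsDoublePalindrome d N → d ∈ dimensions
  dimension-to (N , p) with find (complete-entries p)
  ... | e , e∈ , refl , _ = All.lookup (decided (All.all? (λ e → dimension e ∈? dimensions) entries) refl) e∈

  dimension-from : ∀ {d} → d ∈ dimensions → ∃[ N ] IsDoublePalindrome d N
  dimension-from d∈ =
    let e , e∈ , d≡ = find (All.lookup
          (decided (All.all? (λ d → any? (λ e → d ℕ.≟ dimension e) entries) dimensions) refl) d∈)
    in member e , subst (λ d → IsDoublePalindrome d (member e)) (sym d≡) (sound-entries e∈)
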